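{- Let $w\in S_n$, let $C^L(w)$ be the leaping climbing chain of $w$, and fix any term order on monomials in $x_1,\ldots,x_n$ with $x_1>x_2>\cdots>x_n$. Then the leading monomial of the Schubert polynomial $\mathfrak{S}_w$ is $\mathbf{x}^{\mathrm{wt}(C^L(w),C^L(w))}$.
   Context: Conventions. Permutations are in one-line notation; $t_{ij}$ is the transposition of $i,j$, and $wt_{ij}$ is $w$ with the values in positions $i$ and $j$ exchanged; $s_j=t_{j,j+1}$. $w_0\in S_n$ is the longest permutation, $w_0(k)=n+1-k$. The Bruhat order is the transitive closure of $w\le wt_{ij}$ for $i<j$ with $w(i)<w(j)$; $\lessdot$ denotes its cover relation. $\mathbf{x}^v=\prod_kx_k^{v_k}$. The leading monomial of a polynomial is the largest monomial (without coefficient) appearing in it. Schubert polynomials. With $\partial_j(f)=\frac{f-s_j\cdot f}{x_j-x_{j+1}}$ on $\mathbb{Z}[x_1,\ldots,x_n]$ ($s_j$ exchanging $x_j$ and $x_{j+1}$), $\mathfrak{S}_{w_0}=x_1^{n-1}x_2^{n-2}\cdots x_{n-1}$ and $\mathfrak{S}_w=\partial_j\mathfrak{S}_{ws_j}$ whenever $w(j)<w(j+1)$. Leaping chain. For $w\ne w_0$ set $a=\min\{k\mid w(k)\ne n+1-k\}$, $b=\min\{k\mid k>a\text{ and }w\lessdot wt_{ak}\}$, and $\mathrm{leap}(w)=(a,b)$. $C^L(w_0)$ is the empty sequence; for $w\neq w_0$ with $\mathrm{leap}(w)=(a,b)$, $C^L(w)$ is obtained by prepending $(a,b)$ to $C^L(wt_{ab})$.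 Weight. For such a sequence $C$ of pairs (links), with all links marked, $\mathrm{wt}(C,C)\in\mathbb{Z}^n$ is the vector with $\mathrm{wt}(C,C)_k=n-k-\#\{\text{links of the form }(k,\star)\text{ in }C\}$. -}

module Defs where

open import Level using (Level)
open import Data.Nat.Base as ℕ using (ℕ; suc)
open import Data.Integer.Base as ℤ using (ℤ; +_; 0ℤ; 1ℤ)
open import Data.Fin.Base as Fin using (Fin; toℕ)
open import Data.Fin.Properties using (_≟_)
open import Data.Fin.Permutation as Perm
  using (Permutation′; _⟨$⟩ʳ_; _∘ₚ_; transpose; reverse)
open import Data.Vec.Base as Vec using (Vec; tabulate; lookup; zipWith; replicate)
import Data.Vec.Properties as Vec
open import Data.List.Base as List
  using (List; []; _∷_; [_]; _++_; map; cartesianProductWith; filter; length)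
open import Data.Nat.Properties using () renaming (_≟_ to _≟ⁿ_)
open import Data.Bool.Base using (if_then_else_)
open import Data.Product.Base using (_×_; _,_; proj₁; map₁; map₂; ∃-syntax)
open import Relation.Nullary using (¬_; does)
open import Relation.Unary using (Pred)
open import Relation.Binary.Core using (Rel)
open import Relation.Binary.Structures using (IsTotalOrder)
open import Relation.Binary.Construct.Closure.Transitive using (TransClosure)
open import Relation.Binary.Construct.NonStrictToStrict using () renaming (_<_ to StrictPart)
open import Relation.Binary.PropositionalEquality.Core using (_≡_; _≢_)

-- Positions, values and variables are indexed by Fin n, i.e. from 0: the
-- element k of Fin n stands for the number toℕ k + 1.

private
  variable
    n : ℕ
    ℓ : Level

------------------------------------------------------------------------
-- Permutations and Bruhat order

-- π ∘ₚ ρ applies π first, so this is w with the values in positions i and j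
-- exchanged.
infixl 8 _·t[_,_]

_·t[_,_] : Permutation′ n → Fin n → Fin n → Permutation′ n
w ·t[ i , j ] = transpose i j ∘ₚ w

-- Permutations are identified when they agree pointwise (Perm._≈_).
BruhatStep : Permutation′ n → Permutation′ n → Set
BruhatStep w v = ∃[ i ] ∃[ j ]
  (i Fin.< j × (w ⟨$⟩ʳ i) Fin.< (w ⟨$⟩ʳ j) × v Perm.≈ (w ·t[ i , j ]))

-- The strict part of Bruhat order: every step strictly increases the number
-- of inversions, so a composite of one or more steps is never an identity.
infix 4 _<ᴮ_ _⋖_

_<ᴮ_ : Permutation′ n → Permutation′ n → Set
_<ᴮ_ = TransClosure BruhatStep

_⋖_ : Permutation′ n → Permutation′ n → Set
w ⋖ v = w <ᴮ v × ¬ (∃[ u ] (w <ᴮ u × u <ᴮ v))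

------------------------------------------------------------------------
-- Leaping chains

IsMin : Pred (Fin n) ℓ → Pred (Fin n) ℓ
IsMin P k = P k × (∀ j → P j → k Fin.≤ j)

-- The longest permutation w₀ is the library's reverse.
record IsLeap (w : Permutation′ n) (a b : Fin n) : Set where
  field
    a-min : IsMin (λ k → (w ⟨$⟩ʳ k) ≢ (reverse ⟨$⟩ʳ k)) a
    b-min : IsMin (λ k → a Fin.< k × w ⋖ (w ·t[ a , k ])) b

Chain : ℕ → Set
Chain n = List (Fin n × Fin n)

-- LeapingChain w C says that C is C^L(w).
data LeapingChain {n} : Permutation′ n → Chain n → Set where
  done : ∀ {w} → w Perm.≈ reverse → LeapingChain w []
  leap : ∀ {w a b C} → ¬ (w Perm.≈ reverse) → IsLeap w a b →
         LeapingChain (w ·t[ a , b ]) C → LeapingChain w ((a , b) ∷ C)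

linksFrom : Fin n → Chain n → ℕ
linksFrom k C = length (filter (λ link → proj₁ link ≟ k) C)

-- The weight wt(C , C), in which every link of C is marked.
wt : Chain n → Vec ℤ n
wt {n} C = tabulate λ k →
  + n ℤ.- + suc (toℕ k) ℤ.- + linksFrom k C

------------------------------------------------------------------------
-- Polynomials in x₁,…,xₙ over ℤ

-- A monomial is given by its vector of exponents.
Monomial : ℕ → Set
Monomial n = Vec ℕ n

one : Monomial n
one = replicate _ 0

infixl 7 _·_

_·_ : Monomial n → Monomial n → Monomial n
_·_ = zipWith ℕ._+_

x : Fin n → Monomial n
x i = tabulate λ k → if does (k ≟ i) then 1 else 0

-- A formal sum of terms, in which a monomial may occur repeatedly or with
-- coefficient 0; only the collected coefficients are significant.
Polynomial : ℕ → Set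
Polynomial n = List (ℤ × Monomial n)

coeff : Polynomial n → Monomial n → ℤ
coeff []             v = 0ℤ
coeff ((c , u) ∷ f) v =
  (if does (Vec.≡-dec _≟ⁿ_ u v) then c else 0ℤ) ℤ.+ coeff f v

infix 4 _≈_

_≈_ : Polynomial n → Polynomial n → Set
f ≈ g = ∀ v → coeff f v ≡ coeff g v

infixl 6 _-_
infixl 7 _*_

_-_ : Polynomial n → Polynomial n → Polynomial n
f - g = f ++ map (map₁ λ c → ℤ.- c) g

mulTerm : ℤ × Monomial n → ℤ × Monomial n → ℤ × Monomial n
mulTerm (c , u) (d , v) = c ℤ.* d , u · v

_*_ : Polynomial n → Polynomial n → Polynomial n
_*_ = cartesianProductWith mulTerm

⟦_⟧ : Monomial n → Polynomial n
⟦ u ⟧ = [ (1ℤ , u) ]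

swapVars : Fin n → Fin n → Polynomial n → Polynomial n
swapVars i j = map (map₂ λ u → tabulate λ k → lookup u (transpose i j ⟨$⟩ʳ k))

------------------------------------------------------------------------
-- Schubert polynomials

-- g = (f - s·f) / (xᵢ - xⱼ), where s exchanges xᵢ and xⱼ. The quotient is
-- unique because polynomials over ℤ have no zero divisors.
IsDividedDifference : Fin n → Fin n → Polynomial n → Polynomial n → Set
IsDividedDifference i j f g =
  (⟦ x i ⟧ - ⟦ x j ⟧) * g ≈ f - swapVars i j f

-- 𝔖 is the family (𝔖_w), for w in S_n. The adjacent positions j and j + 1
-- appear as i and j with toℕ j ≡ suc (toℕ i), so that ·t[ i , j ] is right
-- multiplication by a simple transposition.
record IsSchubertFamily {n} (𝔖 : Permutation′ n → Polynomial n) : Set where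
  field
    respects  : ∀ {w v} → w Perm.≈ v → 𝔖 w ≈ 𝔖 v
    longest   : 𝔖 reverse ≈ ⟦ tabulate (λ k → n ℕ.∸ suc (toℕ k)) ⟧
    recursion : ∀ w i j → toℕ j ≡ suc (toℕ i) →
                (w ⟨$⟩ʳ i) Fin.< (w ⟨$⟩ʳ j) →
                IsDividedDifference i j (𝔖 (w ·t[ i , j ])) (𝔖 w)

------------------------------------------------------------------------
-- Term orders and leading monomials

record IsTermOrder {n ℓ} (_≼_ : Rel (Monomial n) ℓ) : Set ℓ where
  field
    isTotalOrder : IsTotalOrder _≡_ _≼_
    one-minimum  : ∀ u → one ≼ u
    ·-monoˡ      : ∀ {u v} t → u ≼ v → (u · t) ≼ (v · t)

VariablesDecreasing : Rel (Monomial n) ℓ → Set ℓ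
VariablesDecreasing _≼_ = ∀ {i j} → i Fin.< j → StrictPart _≡_ _≼_ (x j) (x i)

IsLeadingMonomial : Rel (Monomial n) ℓ → Polynomial n → Monomial n → Set ℓ
IsLeadingMonomial _≼_ f u =
  coeff f u ≢ 0ℤ × (∀ v → coeff f v ≢ 0ℤ → v ≼ u)

{-# OPTIONS --safe #-}
-- The leading exponent of 𝔖_w is top w, the partition conjugate to the code of
-- w⁻¹. Suppose w agrees with w₀ before position a but not at a. Monk's rule then
-- loses its negative terms and its term outside S_n and becomes the transition
--   x_a 𝔖_w = Σ 𝔖_{w t_ak}, summed over the k > a with w ⋖ w t_ak.
-- It is proved by going down from w₀ with divided differences: ∂_j with j > a
-- permutes the terms, and ∂_a(x_{a+1} f) = x_a ∂_a f − f lowers a.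
-- For a cover, top (w t_ak) is top w times x_l, where l ≥ a is one more than the
-- number of values larger than w(k) to the left of k. So no term exceeds
-- top w · x_a in the term order, and l = a for the first k with w(k) > w(a),
-- which is the leap. All coefficients are nonnegative, so nothing cancels.
module Submission where

open import Defs
open import Algebra.Bundles using (CommutativeMonoid)
import Algebra.Properties.CommutativeMonoid.Sum as Sums
open import Data.Bool.Base using (true; false; if_then_else_)
open import Data.Empty using (⊥-elim)
open import Data.Fin.Base as Fin using (Fin; zero; suc; toℕ; fromℕ<; opposite; inject₁; punchIn)
open import Data.Fin.Permutation as Perm using (Permutation′; _⟨$⟩ʳ_; _⟨$⟩ˡ_; reverse; transpose; inverseˡ; inverseʳ)
open import Data.Fin.Properties using (_≟_; _<?_; all?; toℕ-injective; toℕ-inject₁; toℕ-fromℕ<; toℕ<n; punchInᵢ≢i; opposite-prop; opposite-involutive; ¬∀⟶∃¬)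
open import Data.Integer.Base as ℤ using (ℤ; +_; 0ℤ; 1ℤ; +≤+; +<+)
import Data.Integer.Properties as ℤ
open import Data.Integer.Tactic.RingSolver using (solve-∀)
open import Data.List.Base as List using ([]; _∷_; _++_)
open import Data.List.Properties using (++-identityʳ)
open import Data.Nat.Base as ℕ using (ℕ; zero; suc; _∸_; s≤s; z≤n)
open import Data.Nat.Induction using (Acc; acc; <-wellFounded)
import Data.Nat.Properties as ℕ
import Data.Nat.Tactic.RingSolver as ℕ-Solver
open import Data.Product.Base using (_×_; _,_; ∃-syntax; proj₁; proj₂; map₁)
open import Data.Sum.Base using (_⊎_; inj₁; inj₂)
open import Data.Vec.Base using (Vec; map; tabulate; lookup; zipWith)
open import Data.Vec.Functional using (removeAt)
open import Data.Vec.Properties using (≡-dec; lookup∘tabulate; tabulate∘lookup; tabulate-cong; lookup-zipWith; lookup-map)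
open import Function.Base using (_∘_; case_of_)
open import Level using (Level)
open import Relation.Binary.Construct.Closure.Transitive using () renaming ([_] to [_]⁺; _∷_ to _∷⁺_; _++_ to _++⁺_)
open import Relation.Binary.Core using (Rel)
open import Relation.Binary.PropositionalEquality hiding (setoid)
open import Relation.Binary.Structures using (IsTotalOrder)
open import Relation.Nullary using (Dec; yes; no; does; ¬_; ¬?)
open import Relation.Nullary.Decidable using (dec-true; dec-false; map′; _×-dec_; _→-dec_)
open import Relation.Unary using (Decidable)
open ≡-Reasoning

-- Monk's rule for x_a 𝔖_w subtracts the covers that exchange `a` with an earlier position of
-- smaller value. There are none, because the positions before `a` hold the largest values. A cover
-- exchanging `a` with position n + 1 is blocked by the value `opposite a`, which exceeds w(a) and
-- stands further right. The induction looks first at the ascent that ends at this value. If the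
-- ascent starts at `a` itself, its upper value dominates everything else to the right of `a`; the
-- covers at `a` then correspond to the covers one place further right after the exchange, except
-- for one, which is the term -f of the Leibniz rule. A second obstacle is that a leap is defined
-- through `⋖`, a statement about the whole Bruhat order, whereas the formula uses the local
-- condition `Cover`. The two are compared at the first later position with a larger value, by
-- counting points of the permutation matrix in corners.

module ∑ℕ = Sums ℕ.+-0-commutativeMonoid
module ∑ℤ = Sums ℤ.+-0-commutativeMonoid

private
  variable
    n : ℕ

-- Transpositions acting on positions

τ : Fin n → Fin n → Fin n → Fin n
τ i j k = transpose i j ⟨$⟩ʳ k

τ-first : (i j : Fin n) → τ i j i ≡ j
τ-first i j rewrite dec-true (i ≟ i) refl = refl

τ-second : (i j : Fin n) → τ i j j ≡ i
τ-second i j with j ≟ i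
... | yes j≡i = j≡i
... | no _ rewrite dec-true (j ≟ j) refl = refl

τ-other : ∀ (i j : Fin n) {k} → k ≢ i → k ≢ j → τ i j k ≡ k
τ-other i j {k} k≢i k≢j rewrite dec-false (k ≟ i) k≢i | dec-false (k ≟ j) k≢j = refl

τ-involutive : ∀ (i j k : Fin n) → τ i j (τ i j k) ≡ k
τ-involutive i j k with k ≟ i
... | yes k≡i = trans (τ-second i j) (sym k≡i)
... | no k≢i with k ≟ j
...   | yes k≡j = trans (τ-first i j) (sym k≡j)
...   | no k≢j = τ-other i j k≢i k≢j

-- Monomials

lookup-extensional : ∀ {A : Set} {u v : Vec A n} → (∀ k → lookup u k ≡ lookup v k) → u ≡ v
lookup-extensional {u = u} {v} eq = begin
  u                   ≡⟨ tabulate∘lookup u ⟨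
  tabulate (lookup u) ≡⟨ tabulate-cong eq ⟩
  tabulate (lookup v) ≡⟨ tabulate∘lookup v ⟩
  v                   ∎

lookup-· : ∀ (u v : Monomial n) k → lookup (u · v) k ≡ lookup u k ℕ.+ lookup v k
lookup-· u v k = lookup-zipWith ℕ._+_ k u v

lookup-x-same : (i : Fin n) → lookup (x i) i ≡ 1
lookup-x-same i = trans (lookup∘tabulate _ i) (cong (if_then 1 else 0) (dec-true (i ≟ i) refl))

lookup-x-other : ∀ {i k : Fin n} → k ≢ i → lookup (x i) k ≡ 0
lookup-x-other {i = i} {k} k≢i = trans (lookup∘tabulate _ k) (cong (if_then 1 else 0) (dec-false (k ≟ i) k≢i))

·-comm : (u v : Monomial n) → u · v ≡ v · u
·-comm u v = lookup-extensional λ k → begin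
  lookup (u · v) k            ≡⟨ lookup-· u v k ⟩
  lookup u k ℕ.+ lookup v k   ≡⟨ ℕ.+-comm (lookup u k) _ ⟩
  lookup v k ℕ.+ lookup u k   ≡⟨ lookup-· v u k ⟨
  lookup (v · u) k            ∎

·-assoc : (t u v : Monomial n) → (t · u) · v ≡ t · (u · v)
·-assoc t u v = lookup-extensional λ k → begin
  lookup ((t · u) · v) k                      ≡⟨ lookup-· (t · u) v k ⟩
  lookup (t · u) k ℕ.+ lookup v k             ≡⟨ cong (ℕ._+ lookup v k) (lookup-· t u k) ⟩
  lookup t k ℕ.+ lookup u k ℕ.+ lookup v k    ≡⟨ ℕ.+-assoc (lookup t k) _ _ ⟩
  lookup t k ℕ.+ (lookup u k ℕ.+ lookup v k)  ≡⟨ cong (lookup t k ℕ.+_) (lookup-· u v k) ⟨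
  lookup t k ℕ.+ lookup (u · v) k             ≡⟨ lookup-· t (u · v) k ⟨
  lookup (t · (u · v)) k                      ∎

·-right-comm : (t u v : Monomial n) → (t · u) · v ≡ (t · v) · u
·-right-comm t u v = begin
  (t · u) · v ≡⟨ ·-assoc t u v ⟩
  t · (u · v) ≡⟨ cong (t ·_) (·-comm u v) ⟩
  t · (v · u) ≡⟨ ·-assoc t v u ⟨
  (t · v) · u ∎

·-cancelʳ : ∀ (t : Monomial n) {u v} → u · t ≡ v · t → u ≡ v
·-cancelʳ t {u} {v} eq = lookup-extensional λ k → ℕ.+-cancelʳ-≡ (lookup t k) _ _ (begin
  lookup u k ℕ.+ lookup t k ≡⟨ lookup-· u t k ⟨
  lookup (u · t) k          ≡⟨ cong (λ m → lookup m k) eq ⟩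
  lookup (v · t) k          ≡⟨ lookup-· v t k ⟩
  lookup v k ℕ.+ lookup t k ∎)

lookup-·x-same : ∀ (u : Monomial n) i → lookup (u · x i) i ≡ suc (lookup u i)
lookup-·x-same u i = begin
  lookup (u · x i) i              ≡⟨ lookup-· u (x i) i ⟩
  lookup u i ℕ.+ lookup (x i) i   ≡⟨ cong (lookup u i ℕ.+_) (lookup-x-same i) ⟩
  lookup u i ℕ.+ 1                ≡⟨ ℕ.+-comm (lookup u i) 1 ⟩
  suc (lookup u i)                ∎

lookup-·x-other : ∀ (u : Monomial n) {i k} → k ≢ i → lookup (u · x i) k ≡ lookup u k
lookup-·x-other u {i} {k} k≢i = begin
  lookup (u · x i) k              ≡⟨ lookup-· u (x i) k ⟩
  lookup u k ℕ.+ lookup (x i) k   ≡⟨ cong (lookup u k ℕ.+_) (lookup-x-other k≢i) ⟩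
  lookup u k ℕ.+ 0                ≡⟨ ℕ.+-identityʳ _ ⟩
  lookup u k                      ∎

infixl 7 _÷_

_÷_ : Monomial n → Monomial n → Monomial n
_÷_ = zipWith _∸_

·-÷ : (u t : Monomial n) → (u · t) ÷ t ≡ u
·-÷ u t = lookup-extensional λ k → begin
  lookup ((u · t) ÷ t) k                      ≡⟨ lookup-zipWith _∸_ k (u · t) t ⟩
  lookup (u · t) k ∸ lookup t k               ≡⟨ cong (_∸ lookup t k) (lookup-· u t k) ⟩
  lookup u k ℕ.+ lookup t k ∸ lookup t k      ≡⟨ ℕ.m+n∸n≡m (lookup u k) (lookup t k) ⟩
  lookup u k                                  ∎

-- A view: matching on `times` turns a monomial into an actual product, so arguments about `shift`
-- need not handle the truncated subtraction in `÷`.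
data Divisibility (i : Fin n) : Monomial n → Set where
  free  : ∀ {v} → lookup v i ≡ 0 → Divisibility i v
  times : ∀ u → Divisibility i (u · x i)

divisibility : ∀ (i : Fin n) v → Divisibility i v
divisibility i v with lookup v i ℕ.≟ 0
... | yes vᵢ≡0 = free vᵢ≡0
... | no  vᵢ≢0 = subst (Divisibility i) (lookup-extensional ÷-·) (times (v ÷ x i))
  where
  ÷-· : ∀ k → lookup ((v ÷ x i) · x i) k ≡ lookup v k
  ÷-· k = begin
    lookup ((v ÷ x i) · x i) k                        ≡⟨ lookup-· (v ÷ x i) (x i) k ⟩
    lookup (v ÷ x i) k ℕ.+ lookup (x i) k             ≡⟨ cong (ℕ._+ lookup (x i) k) (lookup-zipWith _∸_ k v (x i)) ⟩
    (lookup v k ∸ lookup (x i) k) ℕ.+ lookup (x i) k  ≡⟨ ℕ.m∸n+n≡m xᵢ≤v ⟩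
    lookup v k                                        ∎
    where
    xᵢ≤v : lookup (x i) k ℕ.≤ lookup v k
    xᵢ≤v with k ≟ i
    ... | yes refl = subst (ℕ._≤ lookup v k) (sym (lookup-x-same k)) (ℕ.n≢0⇒n>0 vᵢ≢0)
    ... | no k≢i   = subst (ℕ._≤ lookup v k) (sym (lookup-x-other k≢i)) ℕ.z≤n

opaque
  -- Opaque, so that goals keep the folded form. It is unfolded only to match the map on exponents
  -- inside `swapVars`.
  swap : Fin n → Fin n → Monomial n → Monomial n
  swap i j u = tabulate (λ k → lookup u (τ i j k))

  lookup-swap : ∀ (i j : Fin n) u k → lookup (swap i j u) k ≡ lookup u (τ i j k)
  lookup-swap i j u k = lookup∘tabulate _ k

swap-involutive : ∀ (i j : Fin n) u → swap i j (swap i j u) ≡ u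
swap-involutive i j u = lookup-extensional λ k → begin
  lookup (swap i j (swap i j u)) k  ≡⟨ lookup-swap i j _ k ⟩
  lookup (swap i j u) (τ i j k)     ≡⟨ lookup-swap i j u _ ⟩
  lookup u (τ i j (τ i j k))        ≡⟨ cong (lookup u) (τ-involutive i j k) ⟩
  lookup u k                        ∎

swap-· : ∀ (i j : Fin n) u v → swap i j (u · v) ≡ swap i j u · swap i j v
swap-· i j u v = lookup-extensional λ k → begin
  lookup (swap i j (u · v)) k                           ≡⟨ lookup-swap i j _ k ⟩
  lookup (u · v) (τ i j k)                              ≡⟨ lookup-· u v _ ⟩
  lookup u (τ i j k) ℕ.+ lookup v (τ i j k)             ≡⟨ cong₂ ℕ._+_ (lookup-swap i j u k) (lookup-swap i j v k) ⟨
  lookup (swap i j u) k ℕ.+ lookup (swap i j v) k       ≡⟨ lookup-· (swap i j u) _ k ⟨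
  lookup (swap i j u · swap i j v) k                    ∎

swap-x : ∀ (i j k : Fin n) → swap i j (x k) ≡ x (τ i j k)
swap-x i j k = lookup-extensional λ m → trans (lookup-swap i j (x k) m) (lookup-x m)
  where
  lookup-x : ∀ m → lookup (x k) (τ i j m) ≡ lookup (x (τ i j k)) m
  lookup-x m with m ≟ τ i j k
  ... | yes refl = trans (cong (lookup (x k)) (τ-involutive i j k))
                         (trans (lookup-x-same k) (sym (lookup-x-same m)))
  ... | no m≢τk = trans (lookup-x-other λ τm≡k → m≢τk (trans (sym (τ-involutive i j m)) (cong (τ i j) τm≡k)))
                        (sym (lookup-x-other m≢τk))

-- Formal power series and divided differences

-- Working with coefficient functions turns `≈` of formal sums into pointwise equality and leaves no
-- normal form of a polynomial to maintain.
Series : ℕ → Set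
Series n = Monomial n → ℤ

opaque
  -- Multiplication by the variable xᵢ.
  shift : Fin n → Series n → Series n
  shift i F v = if does (lookup v i ℕ.≟ 0) then 0ℤ else F (v ÷ x i)

  shift-free : ∀ {i : Fin n} F {v} → lookup v i ≡ 0 → shift i F v ≡ 0ℤ
  shift-free {i = i} F {v} vᵢ≡0 = cong (if_then 0ℤ else F (v ÷ x i)) (dec-true (lookup v i ℕ.≟ 0) vᵢ≡0)

  shift-times : ∀ (i : Fin n) F u → shift i F (u · x i) ≡ F u
  shift-times i F u = trans
    (cong (if_then 0ℤ else F (u · x i ÷ x i))
          (dec-false (lookup (u · x i) i ℕ.≟ 0) λ eq → ℕ.1+n≢0 (trans (sym (lookup-·x-same u i)) eq)))
    (cong F (·-÷ u (x i)))

shift-cong : ∀ (i : Fin n) {F G} → F ≗ G → shift i F ≗ shift i G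
shift-cong i {F} {G} F≗G v with divisibility i v
... | free vᵢ≡0 = trans (shift-free F vᵢ≡0) (sym (shift-free G vᵢ≡0))
... | times u = trans (shift-times i F u) (trans (F≗G u) (sym (shift-times i G u)))

shift-difference : ∀ (i : Fin n) F G v →
                   shift i (λ u → F u ℤ.- G u) v ≡ shift i F v ℤ.- shift i G v
shift-difference i F G v with divisibility i v
... | free vᵢ≡0 = trans (shift-free _ vᵢ≡0) (sym (cong₂ ℤ._-_ (shift-free F vᵢ≡0) (shift-free G vᵢ≡0)))
... | times u = trans (shift-times i _ u) (sym (cong₂ ℤ._-_ (shift-times i F u) (shift-times i G u)))

shift-comm : ∀ (i k : Fin n) F v → shift i (shift k F) v ≡ shift k (shift i F) v
shift-comm i k F v with i ≟ k
... | yes refl = refl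
... | no i≢k with divisibility i v
...   | free vᵢ≡0 = trans (shift-free _ vᵢ≡0) (sym shift-zero)
  where
  shift-zero : shift k (shift i F) v ≡ 0ℤ
  shift-zero with divisibility k v
  ... | free vₖ≡0 = shift-free _ vₖ≡0
  ... | times u = trans (shift-times k _ u) (shift-free F (trans (sym (lookup-·x-other u i≢k)) vᵢ≡0))
...   | times u with divisibility k u
...     | free uₖ≡0 = begin
  shift i (shift k F) (u · x i) ≡⟨ shift-times i _ u ⟩
  shift k F u                   ≡⟨ shift-free F uₖ≡0 ⟩
  0ℤ                            ≡⟨ shift-free _ (trans (lookup-·x-other u (i≢k ∘ sym)) uₖ≡0) ⟨
  shift k (shift i F) (u · x i) ∎
...     | times t = begin
  shift i (shift k F) (t · x k · x i) ≡⟨ shift-times i _ _ ⟩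
  shift k F (t · x k)                 ≡⟨ shift-times k F t ⟩
  F t                                 ≡⟨ shift-times i F t ⟨
  shift i F (t · x i)                 ≡⟨ shift-times k _ _ ⟨
  shift k (shift i F) (t · x i · x k) ≡⟨ cong (shift k (shift i F)) (·-right-comm t (x i) (x k)) ⟩
  shift k (shift i F) (t · x k · x i) ∎

-- Exchanging variables is a ring automorphism that sends x_k to x_(s k), where s = `τ i j`.
shift-swap : ∀ (i j k : Fin n) F v → shift k (F ∘ swap i j) v ≡ shift (τ i j k) F (swap i j v)
shift-swap i j k F v with divisibility k v
... | free vₖ≡0 = trans (shift-free _ vₖ≡0) (sym (shift-free F (begin
  lookup (swap i j v) (τ i j k) ≡⟨ lookup-swap i j v _ ⟩
  lookup v (τ i j (τ i j k))    ≡⟨ cong (lookup v) (τ-involutive i j k) ⟩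
  lookup v k                    ≡⟨ vₖ≡0 ⟩
  0                             ∎)))
... | times u = begin
  shift k (F ∘ swap i j) (u · x k)                  ≡⟨ shift-times k _ u ⟩
  F (swap i j u)                                    ≡⟨ shift-times (τ i j k) F _ ⟨
  shift (τ i j k) F (swap i j u · x (τ i j k))      ≡⟨ cong (λ m → shift (τ i j k) F (swap i j u · m)) (swap-x i j k) ⟨
  shift (τ i j k) F (swap i j u · swap i j (x k))   ≡⟨ cong (shift (τ i j k) F) (swap-· i j u (x k)) ⟨
  shift (τ i j k) F (swap i j (u · x k))            ∎

-- G is the divided difference ∂F, in a form without division.
infix 4 _∂[_,_]_

record _∂[_,_]_ (F : Series n) (i j : Fin n) (G : Series n) : Set where
  constructor divided
  field
    equation : ∀ v → shift i G v ℤ.- shift j G v ≡ F v ℤ.- F (swap i j v)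

open _∂[_,_]_

-- Solving for the coefficient G u of xᵢ u in xᵢ G recurs on the exponent of
-- xⱼ in u, so uniqueness holds even for infinite series.
∂-unique : ∀ {i j : Fin n} {F F′ G G′} → i ≢ j → F ∂[ i , j ] G → F′ ∂[ i , j ] G′ → F ≗ F′ → G ≗ G′
∂-unique {n} {i} {j} {F} {F′} {G} {G′} i≢j ∂G ∂G′ F≗F′ u = equal (lookup u j) u refl
  where
  solve : ∀ {F G} → F ∂[ i , j ] G → ∀ u →
          G u ≡ F (u · x i) ℤ.- F (swap i j (u · x i)) ℤ.+ shift j G (u · x i)
  solve {F} {G} ∂G u = begin
    G u                                               ≡⟨ shift-times i G u ⟨
    shift i G v                                       ≡⟨ minus-plus (shift i G v) (shift j G v) ⟩
    shift i G v ℤ.- shift j G v ℤ.+ shift j G v       ≡⟨ cong (ℤ._+ shift j G v) (equation ∂G v) ⟩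
    F v ℤ.- F (swap i j v) ℤ.+ shift j G v            ∎
    where
    v = u · x i
    minus-plus : ∀ a b → a ≡ a ℤ.- b ℤ.+ b
    minus-plus = solve-∀

  equal : ∀ m u → lookup u j ≡ m → G u ≡ G′ u

  equal-shift : ∀ m u → lookup u j ≡ m → shift j G (u · x i) ≡ shift j G′ (u · x i)
  equal-shift m u uⱼ≡m with divisibility j u
  ... | free uⱼ≡0 = trans (shift-free G vⱼ≡0) (sym (shift-free G′ vⱼ≡0))
    where vⱼ≡0 = trans (lookup-·x-other u (i≢j ∘ sym)) uⱼ≡0
  equal-shift zero u uⱼ≡m | times t = ⊥-elim (ℕ.1+n≢0 (trans (sym (lookup-·x-same t j)) uⱼ≡m))
  equal-shift (suc m) u uⱼ≡m | times t rewrite ·-right-comm t (x j) (x i) = begin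
    shift j G (t · x i · x j)   ≡⟨ shift-times j G _ ⟩
    G (t · x i)                 ≡⟨ equal m (t · x i) (begin
      lookup (t · x i) j            ≡⟨ lookup-·x-other t (i≢j ∘ sym) ⟩
      lookup t j                    ≡⟨ ℕ.suc-injective (trans (sym (lookup-·x-same t j)) uⱼ≡m) ⟩
      m                             ∎) ⟩
    G′ (t · x i)                ≡⟨ shift-times j G′ _ ⟨
    shift j G′ (t · x i · x j)  ∎

  equal m u uⱼ≡m = begin
    G u                                                            ≡⟨ solve ∂G u ⟩
    F v ℤ.- F (swap i j v) ℤ.+ shift j G v                         ≡⟨ cong₂ ℤ._+_ (cong₂ ℤ._-_ (F≗F′ v) (F≗F′ _)) (equal-shift m u uⱼ≡m) ⟩
    F′ v ℤ.- F′ (swap i j v) ℤ.+ shift j G′ v                      ≡⟨ solve ∂G′ u ⟨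
    G′ u                                                           ∎
    where v = u · x i

∂-resp : ∀ {i j : Fin n} {F F′ G G′} → F ≗ F′ → G ≗ G′ → F ∂[ i , j ] G → F′ ∂[ i , j ] G′
∂-resp {i = i} {j} {F} {F′} {G} {G′} F≗F′ G≗G′ ∂G .equation v = begin
  shift i G′ v ℤ.- shift j G′ v ≡⟨ cong₂ ℤ._-_ (shift-cong i G≗G′ v) (shift-cong j G≗G′ v) ⟨
  shift i G v ℤ.- shift j G v   ≡⟨ equation ∂G v ⟩
  F v ℤ.- F (swap i j v)        ≡⟨ cong₂ ℤ._-_ (F≗F′ v) (F≗F′ _) ⟩
  F′ v ℤ.- F′ (swap i j v)      ∎

∂-symmetric : ∀ {i j : Fin n} {F} → F ≗ F ∘ swap i j → F ∂[ i , j ] (λ _ → 0ℤ)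
∂-symmetric {i = i} {j} {F} sym-F .equation v = begin
  shift i (λ _ → 0ℤ) v ℤ.- shift j (λ _ → 0ℤ) v ≡⟨ cong₂ ℤ._-_ (shift-0 i) (shift-0 j) ⟩
  0ℤ                                            ≡⟨ ℤ.+-inverseʳ (F v) ⟨
  F v ℤ.- F v                                   ≡⟨ cong (λ c → F v ℤ.- c) (sym-F v) ⟩
  F v ℤ.- F (swap i j v)                        ∎
  where
  shift-0 : ∀ k → shift k (λ _ → 0ℤ) v ≡ 0ℤ
  shift-0 k with divisibility k v
  ... | free vₖ≡0 = shift-free _ vₖ≡0
  ... | times u = shift-times k _ u

-- Exchanging the two variables negates both sides of the defining equation, so `G ∘ swap i j` is a
-- divided difference of the same `F`, and uniqueness applies. This is what makes ∂ vanish on its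
-- own results.
∂-result-symmetric : ∀ {i j : Fin n} {F G} → i ≢ j → F ∂[ i , j ] G → G ≗ G ∘ swap i j
∂-result-symmetric {i = i} {j} {F} {G} i≢j ∂G = ∂-unique i≢j ∂G ∂G∘swap (λ _ → refl)
  where
  negate : ∀ a b → a ℤ.- b ≡ ℤ.- (b ℤ.- a)
  negate = solve-∀

  ∂G∘swap : F ∂[ i , j ] (G ∘ swap i j)
  ∂G∘swap .equation v = begin
    shift i (G ∘ swap i j) v ℤ.- shift j (G ∘ swap i j) v
      ≡⟨ cong₂ ℤ._-_ (trans (shift-swap i j i G v) (cong (λ k → shift k G v′) (τ-first i j)))
                     (trans (shift-swap i j j G v) (cong (λ k → shift k G v′) (τ-second i j))) ⟩
    shift j G v′ ℤ.- shift i G v′           ≡⟨ negate (shift j G v′) _ ⟩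
    ℤ.- (shift i G v′ ℤ.- shift j G v′)     ≡⟨ cong ℤ.-_ (equation ∂G v′) ⟩
    ℤ.- (F v′ ℤ.- F (swap i j v′))          ≡⟨ negate (F (swap i j v′)) (F v′) ⟨
    F (swap i j v′) ℤ.- F v′                ≡⟨ cong (λ m → F m ℤ.- F v′) (swap-involutive i j v) ⟩
    F v ℤ.- F v′                            ∎
    where v′ = swap i j v

∂-+ : ∀ {i j : Fin n} {F F′ G G′} → F ∂[ i , j ] G → F′ ∂[ i , j ] G′ →
      (λ v → F v ℤ.+ F′ v) ∂[ i , j ] (λ v → G v ℤ.+ G′ v)
∂-+ {i = i} {j} {F} {F′} {G} {G′} ∂G ∂G′ .equation v = begin
  shift i (λ u → G u ℤ.+ G′ u) v ℤ.- shift j (λ u → G u ℤ.+ G′ u) v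
    ≡⟨ cong₂ ℤ._-_ (shift-+ i) (shift-+ j) ⟩
  (shift i G v ℤ.+ shift i G′ v) ℤ.- (shift j G v ℤ.+ shift j G′ v)
    ≡⟨ interchange (shift i G v) (shift i G′ v) (shift j G v) (shift j G′ v) ⟩
  (shift i G v ℤ.- shift j G v) ℤ.+ (shift i G′ v ℤ.- shift j G′ v)
    ≡⟨ cong₂ ℤ._+_ (equation ∂G v) (equation ∂G′ v) ⟩
  (F v ℤ.- F (swap i j v)) ℤ.+ (F′ v ℤ.- F′ (swap i j v))
    ≡⟨ interchange (F v) (F′ v) (F (swap i j v)) (F′ (swap i j v)) ⟨
  (F v ℤ.+ F′ v) ℤ.- (F (swap i j v) ℤ.+ F′ (swap i j v)) ∎
  where
  interchange : ∀ a b c d → (a ℤ.+ b) ℤ.- (c ℤ.+ d) ≡ (a ℤ.- c) ℤ.+ (b ℤ.- d)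
  interchange = solve-∀
  shift-+ : ∀ k → shift k (λ u → G u ℤ.+ G′ u) v ≡ shift k G v ℤ.+ shift k G′ v
  shift-+ k with divisibility k v
  ... | free vₖ≡0 = trans (shift-free _ vₖ≡0) (sym (cong₂ ℤ._+_ (shift-free G vₖ≡0) (shift-free G′ vₖ≡0)))
  ... | times u = trans (shift-times k _ u) (sym (cong₂ ℤ._+_ (shift-times k G u) (shift-times k G′ u)))

∂-shift-other : ∀ {i j k : Fin n} {F G} → k ≢ i → k ≢ j →
                F ∂[ i , j ] G → shift k F ∂[ i , j ] shift k G
∂-shift-other {i = i} {j} {k} {F} {G} k≢i k≢j ∂G .equation v = begin
  shift i (shift k G) v ℤ.- shift j (shift k G) v       ≡⟨ cong₂ ℤ._-_ (shift-comm i k G v) (shift-comm j k G v) ⟩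
  shift k (shift i G) v ℤ.- shift k (shift j G) v       ≡⟨ shift-difference k (shift i G) (shift j G) v ⟨
  shift k (λ u → shift i G u ℤ.- shift j G u) v         ≡⟨ shift-cong k (equation ∂G) v ⟩
  shift k (λ u → F u ℤ.- F (swap i j u)) v              ≡⟨ shift-difference k F (F ∘ swap i j) v ⟩
  shift k F v ℤ.- shift k (F ∘ swap i j) v              ≡⟨ cong (λ c → shift k F v ℤ.- c) (shift-swap i j k F v) ⟩
  shift k F v ℤ.- shift (τ i j k) F (swap i j v)        ≡⟨ cong (λ m → shift k F v ℤ.- shift m F (swap i j v)) (τ-other i j k≢i k≢j) ⟩
  shift k F v ℤ.- shift k F (swap i j v)                ∎

-- The Leibniz rule ∂(xⱼ F) = xᵢ ∂F − F.
∂-shift-second : ∀ {i j : Fin n} {F G} → F ∂[ i , j ] G →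
                 shift j F ∂[ i , j ] (λ v → shift i G v ℤ.- F v)
∂-shift-second {i = i} {j} {F} {G} ∂G .equation v = begin
  shift i (λ u → shift i G u ℤ.- F u) v ℤ.- shift j (λ u → shift i G u ℤ.- F u) v
    ≡⟨ cong₂ ℤ._-_ (shift-difference i (shift i G) F v) (shift-difference j (shift i G) F v) ⟩
  (shift i (shift i G) v ℤ.- shift i F v) ℤ.- (shift j (shift i G) v ℤ.- shift j F v)
    ≡⟨ cong (λ c → (shift i (shift i G) v ℤ.- shift i F v) ℤ.- (c ℤ.- shift j F v)) (shift-comm j i G v) ⟩
  (shift i (shift i G) v ℤ.- shift i F v) ℤ.- (shift i (shift j G) v ℤ.- shift j F v)
    ≡⟨ regroup (shift i (shift i G) v) (shift i F v) (shift i (shift j G) v) (shift j F v) ⟩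
  (shift i (shift i G) v ℤ.- shift i (shift j G) v) ℤ.- shift i F v ℤ.+ shift j F v
    ≡⟨ cong (λ c → c ℤ.- shift i F v ℤ.+ shift j F v) ∂G-shifted ⟩
  (shift i F v ℤ.- shift j F (swap i j v)) ℤ.- shift i F v ℤ.+ shift j F v
    ≡⟨ cancel (shift i F v) (shift j F (swap i j v)) (shift j F v) ⟩
  shift j F v ℤ.- shift j F (swap i j v) ∎
  where
  regroup : ∀ a b c d → (a ℤ.- b) ℤ.- (c ℤ.- d) ≡ (a ℤ.- c) ℤ.- b ℤ.+ d
  regroup = solve-∀
  cancel : ∀ a b c → (a ℤ.- b) ℤ.- a ℤ.+ c ≡ c ℤ.- b
  cancel = solve-∀
  -- The equation for `G` multiplied by x_i; the exchange carries x_i times the swapped `F` to x_j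
  -- times `F`.
  ∂G-shifted : shift i (shift i G) v ℤ.- shift i (shift j G) v ≡ shift i F v ℤ.- shift j F (swap i j v)
  ∂G-shifted = begin
    shift i (shift i G) v ℤ.- shift i (shift j G) v ≡⟨ shift-difference i (shift i G) (shift j G) v ⟨
    shift i (λ u → shift i G u ℤ.- shift j G u) v   ≡⟨ shift-cong i (equation ∂G) v ⟩
    shift i (λ u → F u ℤ.- F (swap i j u)) v        ≡⟨ shift-difference i F (F ∘ swap i j) v ⟩
    shift i F v ℤ.- shift i (F ∘ swap i j) v        ≡⟨ cong (λ c → shift i F v ℤ.- c) (shift-swap i j i F v) ⟩
    shift i F v ℤ.- shift (τ i j i) F (swap i j v)  ≡⟨ cong (λ m → shift i F v ℤ.- shift m F (swap i j v)) (τ-first i j) ⟩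
    shift i F v ℤ.- shift j F (swap i j v)          ∎

-- Coefficients of polynomials

coeff-++ : ∀ (f g : Polynomial n) v → coeff (f ++ g) v ≡ coeff f v ℤ.+ coeff g v
coeff-++ [] g v = sym (ℤ.+-identityˡ _)
coeff-++ ((c , u) ∷ f) g v = trans
  (cong (λ d → (if does (≡-dec ℕ._≟_ u v) then c else 0ℤ) ℤ.+ d) (coeff-++ f g v))
  (sym (ℤ.+-assoc (if does (≡-dec ℕ._≟_ u v) then c else 0ℤ) (coeff f v) (coeff g v)))

coeff-negate : ∀ (f : Polynomial n) v → coeff (List.map (map₁ (λ c → ℤ.- c)) f) v ≡ ℤ.- coeff f v
coeff-negate [] v = refl
coeff-negate ((c , u) ∷ f) v with does (≡-dec ℕ._≟_ u v)
... | true = trans (cong (ℤ._+_ (ℤ.- c)) (coeff-negate f v)) (sym (ℤ.neg-distrib-+ c (coeff f v)))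
... | false = trans (cong (ℤ._+_ 0ℤ) (coeff-negate f v)) (sym (ℤ.neg-distrib-+ 0ℤ (coeff f v)))

coeff-difference : ∀ (f g : Polynomial n) v → coeff (f - g) v ≡ coeff f v ℤ.- coeff g v
coeff-difference f g v = trans (coeff-++ f _ v) (cong (λ d → coeff f v ℤ.+ d) (coeff-negate g v))

opaque
  unfolding swap

  coeff-swapVars : ∀ (i j : Fin n) f v → coeff (swapVars i j f) v ≡ coeff f (swap i j v)
  coeff-swapVars i j [] v = refl
  coeff-swapVars i j ((c , u) ∷ f) v = cong₂ (λ b d → (if b then c else 0ℤ) ℤ.+ d) same (coeff-swapVars i j f v)
    where
    same : does (≡-dec ℕ._≟_ (swap i j u) v) ≡ does (≡-dec ℕ._≟_ u (swap i j v))
    same with ≡-dec ℕ._≟_ u (swap i j v)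
    ... | yes u≡v = dec-true (≡-dec ℕ._≟_ (swap i j u) v) (trans (cong (swap i j) u≡v) (swap-involutive i j v))
    ... | no u≢v = dec-false (≡-dec ℕ._≟_ (swap i j u) v)
                     λ eq → u≢v (trans (sym (swap-involutive i j u)) (cong (swap i j) eq))

  coeff-swap-monomial : ∀ (i j : Fin n) u v → coeff ⟦ swap i j u ⟧ v ≡ coeff ⟦ u ⟧ (swap i j v)
  coeff-swap-monomial i j u = coeff-swapVars i j ⟦ u ⟧

coeff-mulTerm : ∀ c (i : Fin n) g v → coeff (List.map (mulTerm (c , x i)) g) v ≡ c ℤ.* shift i (coeff g) v
coeff-mulTerm c i g v with divisibility i v
... | free vᵢ≡0 = trans (vanish g) (sym (trans (cong (λ d → c ℤ.* d) (shift-free (coeff g) vᵢ≡0)) (ℤ.*-zeroʳ c)))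
  where
  vanish : ∀ g → coeff (List.map (mulTerm (c , x i)) g) v ≡ 0ℤ
  vanish [] = refl
  vanish ((d , u) ∷ g) = cong₂ (λ b e → (if b then c ℤ.* d else 0ℤ) ℤ.+ e)
    (dec-false (≡-dec ℕ._≟_ (x i · u) v)
      λ eq → ℕ.1+n≢0 (trans (sym (lookup-·x-same u i))
                            (trans (cong (λ m → lookup m i) (trans (·-comm u (x i)) eq)) vᵢ≡0)))
    (vanish g)
... | times t = trans (scale g) (cong (λ d → c ℤ.* d) (sym (shift-times i (coeff g) t)))
  where
  scale : ∀ g → coeff (List.map (mulTerm (c , x i)) g) (t · x i) ≡ c ℤ.* coeff g t
  scale [] = sym (ℤ.*-zeroʳ c)
  scale ((d , u) ∷ g) with ≡-dec ℕ._≟_ u t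
  ... | yes u≡t = begin
    _ ≡⟨ cong₂ (λ b e → (if b then c ℤ.* d else 0ℤ) ℤ.+ e)
           (dec-true (≡-dec ℕ._≟_ (x i · u) (t · x i)) (trans (·-comm (x i) u) (cong (_· x i) u≡t))) (scale g) ⟩
    c ℤ.* d ℤ.+ c ℤ.* coeff g t ≡⟨ ℤ.*-distribˡ-+ c d (coeff g t) ⟨
    c ℤ.* (d ℤ.+ coeff g t)     ∎
  ... | no u≢t = begin
    _ ≡⟨ cong₂ (λ b e → (if b then c ℤ.* d else 0ℤ) ℤ.+ e)
           (dec-false (≡-dec ℕ._≟_ (x i · u) (t · x i))
             λ eq → u≢t (·-cancelʳ (x i) (trans (·-comm u (x i)) eq))) (scale g) ⟩
    0ℤ ℤ.+ c ℤ.* coeff g t      ≡⟨ ℤ.+-identityˡ _ ⟩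
    c ℤ.* coeff g t             ≡⟨ cong (λ d → c ℤ.* d) (ℤ.+-identityˡ _) ⟨
    c ℤ.* (0ℤ ℤ.+ coeff g t)    ∎

coeff-x-* : ∀ (i j : Fin n) g v →
            coeff ((⟦ x i ⟧ - ⟦ x j ⟧) * g) v ≡ shift i (coeff g) v ℤ.- shift j (coeff g) v
coeff-x-* i j g v = begin
  coeff (List.map (mulTerm (1ℤ , x i)) g ++ List.map (mulTerm (ℤ.- 1ℤ , x j)) g ++ []) v
    ≡⟨ coeff-++ (List.map (mulTerm (1ℤ , x i)) g) _ v ⟩
  coeff (List.map (mulTerm (1ℤ , x i)) g) v ℤ.+ coeff (List.map (mulTerm (ℤ.- 1ℤ , x j)) g ++ []) v
    ≡⟨ cong₂ ℤ._+_ (coeff-mulTerm 1ℤ i g v)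
                   (trans (cong (λ h → coeff h v) (++-identityʳ (List.map (mulTerm (ℤ.- 1ℤ , x j)) g)))
                          (coeff-mulTerm (ℤ.- 1ℤ) j g v)) ⟩
  1ℤ ℤ.* shift i (coeff g) v ℤ.+ ℤ.- 1ℤ ℤ.* shift j (coeff g) v
    ≡⟨ simplify (shift i (coeff g) v) (shift j (coeff g) v) ⟩
  shift i (coeff g) v ℤ.- shift j (coeff g) v ∎
  where
  simplify : ∀ a b → 1ℤ ℤ.* a ℤ.+ ℤ.- 1ℤ ℤ.* b ≡ a ℤ.- b
  simplify = solve-∀

∂-coeff : ∀ {i j : Fin n} {f g} → IsDividedDifference i j f g → coeff f ∂[ i , j ] coeff g
∂-coeff {i = i} {j} {f} {g} dd .equation v = begin
  shift i (coeff g) v ℤ.- shift j (coeff g) v   ≡⟨ coeff-x-* i j g v ⟨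
  coeff ((⟦ x i ⟧ - ⟦ x j ⟧) * g) v             ≡⟨ dd v ⟩
  coeff (f - swapVars i j f) v                  ≡⟨ coeff-difference f (swapVars i j f) v ⟩
  coeff f v ℤ.- coeff (swapVars i j f) v        ≡⟨ cong (λ c → coeff f v ℤ.- c) (coeff-swapVars i j f v) ⟩
  coeff f v ℤ.- coeff f (swap i j v)            ∎

shift-monomial-symmetric : ∀ (i j : Fin n) u → swap i j (x j · u) ≡ x j · u →
                           shift j (coeff ⟦ u ⟧) ≗ shift j (coeff ⟦ u ⟧) ∘ swap i j
shift-monomial-symmetric i j u symmetric v = begin
  shift j (coeff ⟦ u ⟧) v                     ≡⟨ product v ⟨
  coeff ⟦ x j · u ⟧ v                         ≡⟨ cong (λ m → coeff ⟦ m ⟧ v) symmetric ⟨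
  coeff ⟦ swap i j (x j · u) ⟧ v              ≡⟨ coeff-swap-monomial i j (x j · u) v ⟩
  coeff ⟦ x j · u ⟧ (swap i j v)              ≡⟨ product (swap i j v) ⟩
  shift j (coeff ⟦ u ⟧) (swap i j v)          ∎
  where
  product : ∀ v → coeff ⟦ x j · u ⟧ v ≡ shift j (coeff ⟦ u ⟧) v
  product v = trans (coeff-mulTerm 1ℤ j ⟦ u ⟧ v) (ℤ.*-identityˡ _)

-- Finite sums

module _ {c ℓ} (M : CommutativeMonoid c ℓ) where
  open CommutativeMonoid M using (Carrier; _∙_; setoid; ∙-congˡ; ∙-congʳ; comm; assoc) renaming (_≈_ to _≈ᴹ_)
  open Sums M using (sum; sum-remove; sum-cong-≋)
  open import Relation.Binary.Reasoning.Setoid setoid renaming (begin_ to begin-≈_; _∎ to _∎-≈)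

  -- Stated without subtraction, so that one proof serves the counts in ℕ and the coefficients in ℤ.
  sum-update : ∀ {n} (f g : Fin n → Carrier) i → (∀ k → k ≢ i → f k ≈ᴹ g k) →
               sum f ∙ g i ≈ᴹ sum g ∙ f i
  sum-update {suc n} f g i f≈g = begin-≈
    sum f ∙ g i                       ≈⟨ ∙-congʳ (sum-remove f) ⟩
    f i ∙ sum (removeAt f i) ∙ g i    ≈⟨ comm _ _ ⟩
    g i ∙ (f i ∙ sum (removeAt f i))  ≈⟨ ∙-congˡ (comm _ _) ⟩
    g i ∙ (sum (removeAt f i) ∙ f i)  ≈⟨ assoc _ _ _ ⟨
    g i ∙ sum (removeAt f i) ∙ f i    ≈⟨ ∙-congʳ (∙-congˡ (sum-cong-≋ λ k → f≈g (punchIn i k) (punchInᵢ≢i i k))) ⟩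
    g i ∙ sum (removeAt g i) ∙ f i    ≈⟨ ∙-congʳ (sum-remove g) ⟨
    sum g ∙ f i                       ∎-≈

sum-update₂ : ∀ (f g : Fin n → ℕ) {i j} → i ≢ j → (∀ k → k ≢ i → k ≢ j → f k ≡ g k) →
              ∑ℕ.sum f ℕ.+ (g i ℕ.+ g j) ≡ ∑ℕ.sum g ℕ.+ (f i ℕ.+ f j)
sum-update₂ f g {i} {j} i≢j f≡g = begin
  ∑ℕ.sum f ℕ.+ (g i ℕ.+ g j)  ≡⟨ ℕ.+-assoc (∑ℕ.sum f) _ _ ⟨
  ∑ℕ.sum f ℕ.+ g i ℕ.+ g j    ≡⟨ cong (λ m → ∑ℕ.sum f ℕ.+ m ℕ.+ g j) h-same ⟨
  ∑ℕ.sum f ℕ.+ h i ℕ.+ g j    ≡⟨ cong (ℕ._+ g j) (sum-update ℕ.+-0-commutativeMonoid f h i (λ k k≢i → sym (h-other k k≢i))) ⟩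
  ∑ℕ.sum h ℕ.+ f i ℕ.+ g j    ≡⟨ exchange (∑ℕ.sum h) (f i) (g j) ⟩
  ∑ℕ.sum h ℕ.+ g j ℕ.+ f i    ≡⟨ cong (ℕ._+ f i) (sum-update ℕ.+-0-commutativeMonoid h g j h≡g) ⟩
  ∑ℕ.sum g ℕ.+ h j ℕ.+ f i    ≡⟨ cong (λ m → ∑ℕ.sum g ℕ.+ m ℕ.+ f i) (h-other j (i≢j ∘ sym)) ⟩
  ∑ℕ.sum g ℕ.+ f j ℕ.+ f i    ≡⟨ regroup (∑ℕ.sum g) (f j) (f i) ⟩
  ∑ℕ.sum g ℕ.+ (f i ℕ.+ f j)  ∎
  where
  exchange : ∀ a b c → a ℕ.+ b ℕ.+ c ≡ a ℕ.+ c ℕ.+ b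
  exchange = ℕ-Solver.solve-∀
  regroup : ∀ a b c → a ℕ.+ b ℕ.+ c ≡ a ℕ.+ (c ℕ.+ b)
  regroup = ℕ-Solver.solve-∀
  h : Fin _ → ℕ
  h k = if does (k ≟ i) then g k else f k
  h-same : h i ≡ g i
  h-same = cong (if_then g i else f i) (dec-true (i ≟ i) refl)
  h-other : ∀ k → k ≢ i → h k ≡ f k
  h-other k k≢i = cong (if_then g k else f k) (dec-false (k ≟ i) k≢i)
  h≡g : ∀ k → k ≢ j → h k ≡ g k
  h≡g k k≢j with k ≟ i
  ... | yes _ = refl
  ... | no k≢i = f≡g k k≢i k≢j

∂-sum : ∀ {m} {i j : Fin n} (F G : Fin m → Series n) → (∀ k → F k ∂[ i , j ] G k) →
        (λ v → ∑ℤ.sum (λ k → F k v)) ∂[ i , j ] (λ v → ∑ℤ.sum (λ k → G k v))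
∂-sum {m = zero} F G ∂G = ∂-symmetric λ _ → refl
∂-sum {m = suc m} F G ∂G = ∂-+ (∂G zero) (∂-sum (F ∘ suc) (G ∘ suc) (∂G ∘ suc))

-- Permutations

<⇒≢ : {i j : Fin n} → i Fin.< j → i ≢ j
<⇒≢ i<j refl = ℕ.<-irrefl refl i<j

<-resp : ∀ {p q r t : Fin n} → p ≡ q → r ≡ t → p Fin.< r → q Fin.< t
<-resp = subst₂ Fin._<_

permutation-injective : ∀ (w : Permutation′ n) {i j} → w ⟨$⟩ʳ i ≡ w ⟨$⟩ʳ j → i ≡ j
permutation-injective w eq = trans (sym (inverseˡ w)) (trans (cong (w ⟨$⟩ˡ_) eq) (inverseˡ w))

τ-conjugate : ∀ (i j a k m : Fin n) → τ i j (τ a k (τ i j m)) ≡ τ (τ i j a) (τ i j k) m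
τ-conjugate i j a k m with m ≟ τ i j a
... | yes refl = trans (cong (τ i j ∘ τ a k) (τ-involutive i j a)) (cong (τ i j) (τ-first a k))
... | no m≢sa with m ≟ τ i j k
...   | yes refl = trans (cong (τ i j ∘ τ a k) (τ-involutive i j k)) (cong (τ i j) (τ-second a k))
...   | no m≢sk = trans (cong (τ i j) (τ-other a k (moved m≢sa) (moved m≢sk))) (τ-involutive i j m)
  where
  moved : ∀ {l} → m ≢ τ i j l → τ i j m ≢ l
  moved m≢sl sm≡l = m≢sl (trans (sym (τ-involutive i j m)) (cong (τ i j) sm≡l))

-- Two instances matter: `toℕ` twice gives the termination measure, and characteristic functions of
-- up-sets give the rank function that counts the points of the permutation matrix in a corner.
weight : (f g : Fin n → ℕ) → Permutation′ n → ℕ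
weight f g w = ∑ℕ.sum (λ k → f k ℕ.* g (w ⟨$⟩ʳ k))

-- The rearrangement identity: the exchange costs the product of the two differences, which enter as
-- `d` and `e` to avoid subtraction.
weight-step : ∀ (f g : Fin n → ℕ) w {i j} d e → i ≢ j → f j ≡ f i ℕ.+ d →
              g (w ⟨$⟩ʳ j) ≡ g (w ⟨$⟩ʳ i) ℕ.+ e →
              weight f g (w ·t[ i , j ]) ℕ.+ d ℕ.* e ≡ weight f g w
weight-step f g w {i} {j} d e i≢j fj≡ gj≡ = ℕ.+-cancelʳ-≡ after _ _ (begin
  weight f g w′ ℕ.+ d ℕ.* e ℕ.+ after     ≡⟨ shuffle (weight f g w′) (d ℕ.* e) after ⟩
  weight f g w′ ℕ.+ (after ℕ.+ d ℕ.* e)   ≡⟨ cong (weight f g w′ ℕ.+_) rearrangement ⟨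
  weight f g w′ ℕ.+ before                ≡⟨ sum-update₂ (λ k → f k ℕ.* g (w′ ⟨$⟩ʳ k)) (λ k → f k ℕ.* g (w ⟨$⟩ʳ k)) i≢j
                                              (λ k k≢i k≢j → cong (λ m → f k ℕ.* g (w ⟨$⟩ʳ m)) (τ-other i j k≢i k≢j)) ⟩
  weight f g w ℕ.+ (f i ℕ.* g (w′ ⟨$⟩ʳ i) ℕ.+ f j ℕ.* g (w′ ⟨$⟩ʳ j))
    ≡⟨ cong₂ (λ k l → weight f g w ℕ.+ (f i ℕ.* g (w ⟨$⟩ʳ k) ℕ.+ f j ℕ.* g (w ⟨$⟩ʳ l))) (τ-first i j) (τ-second i j) ⟩
  weight f g w ℕ.+ after                  ∎)
  where
  w′ = w ·t[ i , j ]
  before = f i ℕ.* g (w ⟨$⟩ʳ i) ℕ.+ f j ℕ.* g (w ⟨$⟩ʳ j)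
  after  = f i ℕ.* g (w ⟨$⟩ʳ j) ℕ.+ f j ℕ.* g (w ⟨$⟩ʳ i)
  shuffle : ∀ a b c → a ℕ.+ b ℕ.+ c ≡ a ℕ.+ (c ℕ.+ b)
  shuffle = ℕ-Solver.solve-∀
  expand : ∀ a b c d → a ℕ.* b ℕ.+ (a ℕ.+ c) ℕ.* (b ℕ.+ d) ≡ (a ℕ.* (b ℕ.+ d) ℕ.+ (a ℕ.+ c) ℕ.* b) ℕ.+ c ℕ.* d
  expand = ℕ-Solver.solve-∀
  rearrangement : before ≡ after ℕ.+ d ℕ.* e
  rearrangement rewrite fj≡ | gj≡ = expand (f i) (g (w ⟨$⟩ʳ i)) d e

-- This is the sum of k · w(k) rather than a count of non-inverted pairs. Each Bruhat step lowers it
-- by the gap in positions times the gap in values, so it can drive the inductions towards w₀.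
coinversion : Permutation′ n → ℕ
coinversion = weight toℕ toℕ

coinversion-step : ∀ (w : Permutation′ n) {i j} → i Fin.< j → (w ⟨$⟩ʳ i) Fin.< (w ⟨$⟩ʳ j) →
                   coinversion (w ·t[ i , j ]) ℕ.< coinversion w
coinversion-step w {i} {j} i<j wi<wj = subst (coinversion (w ·t[ i , j ]) ℕ.<_)
  (weight-step toℕ toℕ w _ _ (<⇒≢ i<j) (sym (ℕ.m+[n∸m]≡n (ℕ.<⇒≤ i<j))) (sym (ℕ.m+[n∸m]≡n (ℕ.<⇒≤ wi<wj))))
  (ℕ.m<m+n _ (ℕ.*-mono-≤ (ℕ.m<n⇒0<n∸m i<j) (ℕ.m<n⇒0<n∸m wi<wj)))

-- Covers by transpositions

-- The classical local criterion for w ⋖ w t_ak: no point of the permutation matrix lies strictly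
-- inside the rectangle spanned by positions `a` and `k`. Unlike `⋖` it is decidable by a finite
-- search.
record Cover (w : Permutation′ n) (a k : Fin n) : Set where
  constructor cover
  field
    position : a Fin.< k
    value    : (w ⟨$⟩ʳ a) Fin.< (w ⟨$⟩ʳ k)
    between  : ∀ m → a Fin.< m → m Fin.< k → (w ⟨$⟩ʳ a) Fin.< (w ⟨$⟩ʳ m) → ¬ (w ⟨$⟩ʳ m) Fin.< (w ⟨$⟩ʳ k)

open Cover

cover? : ∀ (w : Permutation′ n) a k → Dec (Cover w a k)
cover? w a k = map′ (λ (p , v , b) → cover p v b) (λ c → position c , value c , between c)
  (a <? k ×-dec (w ⟨$⟩ʳ a) <? (w ⟨$⟩ʳ k) ×-dec
   all? λ m → (a <? m) →-dec ((m <? k) →-dec (((w ⟨$⟩ʳ a) <? (w ⟨$⟩ʳ m)) →-dec ¬? ((w ⟨$⟩ʳ m) <? (w ⟨$⟩ʳ k)))))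

Adjacent : Fin n → Fin n → Set
Adjacent j j′ = toℕ j′ ≡ suc (toℕ j)

adjacent-< : {j j′ : Fin n} → Adjacent j j′ → j Fin.< j′
adjacent-< adj = ℕ.≤-reflexive (sym adj)

adjacent-below : ∀ {j j′ k : Fin n} → Adjacent j j′ → k Fin.< j′ → k ≢ j → k Fin.< j
adjacent-below {k = k} adj k<j′ k≢j = ℕ.≤∧≢⇒< (ℕ.≤-pred (subst (suc (toℕ k) ℕ.≤_) adj k<j′)) (k≢j ∘ toℕ-injective)

adjacent-above : ∀ {j j′ k : Fin n} → Adjacent j j′ → j Fin.< k → k ≢ j′ → j′ Fin.< k
adjacent-above {k = k} adj j<k k≢j′ = ℕ.≤∧≢⇒< (subst (ℕ._≤ toℕ k) (sym adj) j<k) (k≢j′ ∘ sym ∘ toℕ-injective)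

predecessor : ∀ {a p : Fin n} → a Fin.< p → ∃[ j ] (Adjacent j p × a Fin.≤ j)
predecessor {a = a} {suc p} (s≤s a≤p) =
  inject₁ p , cong suc (sym (toℕ-inject₁ p)) , subst (toℕ a ℕ.≤_) (sym (toℕ-inject₁ p)) a≤p

≮∧≢⇒> : {i j : Fin n} → ¬ i Fin.< j → i ≢ j → j Fin.< i
≮∧≢⇒> i≮j i≢j = ℕ.≤∧≢⇒< (ℕ.≮⇒≥ i≮j) (i≢j ∘ sym ∘ toℕ-injective)

module _ (w : Permutation′ n) {a j j′ : Fin n} (adj : Adjacent j j′)
         (a<j : a Fin.< j) (ascent : (w ⟨$⟩ʳ j) Fin.< (w ⟨$⟩ʳ j′)) where

  private
    s = τ j j′
    w′ = w ·t[ j , j′ ]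
    a<j′ = ℕ.<-trans a<j (adjacent-< adj)

    fixed : ∀ {m} → m ≢ j → m ≢ j′ → (w′ ⟨$⟩ʳ m) ≡ (w ⟨$⟩ʳ m)
    fixed m≢j m≢j′ = cong (w ⟨$⟩ʳ_) (τ-other j j′ m≢j m≢j′)

    w′a : (w′ ⟨$⟩ʳ a) ≡ (w ⟨$⟩ʳ a)
    w′a = fixed (<⇒≢ a<j) (<⇒≢ a<j′)
    w′j : (w′ ⟨$⟩ʳ j) ≡ (w ⟨$⟩ʳ j′)
    w′j = cong (w ⟨$⟩ʳ_) (τ-first j j′)
    w′j′ : (w′ ⟨$⟩ʳ j′) ≡ (w ⟨$⟩ʳ j)
    w′j′ = cong (w ⟨$⟩ʳ_) (τ-second j j′)

    below : ∀ {m} → m Fin.< j → (w′ ⟨$⟩ʳ m) ≡ (w ⟨$⟩ʳ m)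
    below m<j = fixed (<⇒≢ m<j) (<⇒≢ (ℕ.<-trans m<j (adjacent-< adj)))

    s-above : ∀ {m} → a Fin.< m → a Fin.< s m
    s-above {m} a<m with m ≟ j
    ... | yes _ = a<j′
    ... | no _ with m ≟ j′
    ...   | yes _ = a<j
    ...   | no _ = a<m

    s-below : ∀ {m k} → k ≢ j → k ≢ j′ → m Fin.< k → s m Fin.< k
    s-below {m} k≢j k≢j′ m<k with m ≟ j
    ... | yes refl = adjacent-above adj m<k k≢j′
    ... | no _ with m ≟ j′
    ...   | yes refl = ℕ.<-trans (adjacent-< adj) m<k
    ...   | no _ = m<k

  private
    v′ : Fin n → Permutation′ n
    v′ k = w′ ·t[ a , k ]

    -- The divided difference at j of 𝔖_v is 𝔖_(v s) if v descends at j, and 0 otherwise. So this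
    -- equivalence says that it carries the `k`-th term for `w′` to the term for `w` with index
    -- `s k`.
    Goal : Fin n → Set
    Goal k = (Cover w a (s k) → Cover w′ a k × (v′ k ⟨$⟩ʳ j′) Fin.< (v′ k ⟨$⟩ʳ j)) ×
             (Cover w′ a k → (v′ k ⟨$⟩ʳ j′) Fin.< (v′ k ⟨$⟩ʳ j) → Cover w a (s k))

    -- The only case in which a cover of `w′` can be lost. If w(a) < w(j), then position `j` lies
    -- inside the rectangle of `a` and `j′` for `w`; at the same time `v′ j` ascends at `j`, so its
    -- term is killed.
    at-j : Goal j
    at-j rewrite τ-first j j′ = down , up
      where
      v′j : (v′ j ⟨$⟩ʳ j) ≡ (w ⟨$⟩ʳ a)
      v′j = trans (cong (w′ ⟨$⟩ʳ_) (τ-second a j)) w′a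
      v′j′ : (v′ j ⟨$⟩ʳ j′) ≡ (w ⟨$⟩ʳ j)
      v′j′ = trans (cong (w′ ⟨$⟩ʳ_) (τ-other a j (<⇒≢ a<j′ ∘ sym) (<⇒≢ (adjacent-< adj) ∘ sym))) w′j′
      down : Cover w a j′ → Cover w′ a j × (v′ j ⟨$⟩ʳ j′) Fin.< (v′ j ⟨$⟩ʳ j)
      down c = cover a<j (<-resp (sym w′a) (sym w′j) (value c))
                 (λ m a<m m<j p q → between c m a<m (ℕ.<-trans m<j (adjacent-< adj))
                    (<-resp w′a (below m<j) p) (<-resp (below m<j) w′j q))
             , <-resp (sym v′j′) (sym v′j)
                 (≮∧≢⇒> (λ wa<wj → between c j a<j (adjacent-< adj) wa<wj ascent)
                        (<⇒≢ a<j ∘ permutation-injective w))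
      up : Cover w′ a j → (v′ j ⟨$⟩ʳ j′) Fin.< (v′ j ⟨$⟩ʳ j) → Cover w a j′
      up c d = cover a<j′ (<-resp w′a w′j (value c)) between′
        where
        between′ : ∀ m → a Fin.< m → m Fin.< j′ → (w ⟨$⟩ʳ a) Fin.< (w ⟨$⟩ʳ m) → ¬ (w ⟨$⟩ʳ m) Fin.< (w ⟨$⟩ʳ j′)
        between′ m a<m m<j′ p q = case m ≟ j of λ where
          (yes refl) → ℕ.<-asym p (<-resp v′j′ v′j d)
          (no m≢j) → let m<j = adjacent-below adj m<j′ m≢j in
            between c m a<m m<j (<-resp (sym w′a) (sym (below m<j)) p) (<-resp (sym (below m<j)) (sym w′j) q)

    at-j′ : Goal j′
    at-j′ rewrite τ-second j j′ = down , up
      where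
      v′j : (v′ j′ ⟨$⟩ʳ j) ≡ (w ⟨$⟩ʳ j′)
      v′j = trans (cong (w′ ⟨$⟩ʳ_) (τ-other a j′ (<⇒≢ a<j ∘ sym) (<⇒≢ (adjacent-< adj)))) w′j
      v′j′ : (v′ j′ ⟨$⟩ʳ j′) ≡ (w ⟨$⟩ʳ a)
      v′j′ = trans (cong (w′ ⟨$⟩ʳ_) (τ-second a j′)) w′a
      down : Cover w a j → Cover w′ a j′ × (v′ j′ ⟨$⟩ʳ j′) Fin.< (v′ j′ ⟨$⟩ʳ j)
      down c = cover a<j′ (<-resp (sym w′a) (sym w′j′) (value c)) between′
             , <-resp (sym v′j′) (sym v′j) (ℕ.<-trans (value c) ascent)
        where
        between′ : ∀ m → a Fin.< m → m Fin.< j′ → (w′ ⟨$⟩ʳ a) Fin.< (w′ ⟨$⟩ʳ m) → ¬ (w′ ⟨$⟩ʳ m) Fin.< (w′ ⟨$⟩ʳ j′)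
        between′ m a<m m<j′ p q = case m ≟ j of λ where
          (yes refl) → ℕ.<-asym ascent (<-resp w′j w′j′ q)
          (no m≢j) → let m<j = adjacent-below adj m<j′ m≢j in
            between c m a<m m<j (<-resp w′a (below m<j) p) (<-resp (below m<j) w′j′ q)
      up : Cover w′ a j′ → (v′ j′ ⟨$⟩ʳ j′) Fin.< (v′ j′ ⟨$⟩ʳ j) → Cover w a j
      up c _ = cover a<j (<-resp w′a w′j′ (value c)) λ m a<m m<j p q →
        between c m a<m (ℕ.<-trans m<j (adjacent-< adj))
          (<-resp (sym w′a) (sym (below m<j)) p) (<-resp (sym (below m<j)) (sym w′j′) q)

    elsewhere : ∀ k → k ≢ j → k ≢ j′ → Goal k
    elsewhere k k≢j k≢j′ rewrite τ-other j j′ k≢j k≢j′ = down , up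
      where
      w′k : (w′ ⟨$⟩ʳ k) ≡ (w ⟨$⟩ʳ k)
      w′k = fixed k≢j k≢j′
      down : Cover w a k → Cover w′ a k × (v′ k ⟨$⟩ʳ j′) Fin.< (v′ k ⟨$⟩ʳ j)
      down c = cover (position c) (<-resp (sym w′a) (sym w′k) (value c))
                 -- Here `s` preserves lying strictly between `a` and `k`, so a point inside the
                 -- rectangle for `w′` comes from one for `w`.
                 (λ m a<m m<k p q → between c (s m) (s-above a<m) (s-below k≢j k≢j′ m<k)
                    (<-resp w′a refl p) (<-resp refl w′k q))
             , <-resp (sym (trans (cong (w′ ⟨$⟩ʳ_) (τ-other a k (<⇒≢ a<j′ ∘ sym) (k≢j′ ∘ sym))) w′j′))
                  (sym (trans (cong (w′ ⟨$⟩ʳ_) (τ-other a k (<⇒≢ a<j ∘ sym) (k≢j ∘ sym))) w′j))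
                  ascent
      s-value : ∀ m → (w′ ⟨$⟩ʳ s m) ≡ (w ⟨$⟩ʳ m)
      s-value m = cong (w ⟨$⟩ʳ_) (τ-involutive j j′ m)
      up : Cover w′ a k → (v′ k ⟨$⟩ʳ j′) Fin.< (v′ k ⟨$⟩ʳ j) → Cover w a k
      up c _ = cover (position c) (<-resp w′a w′k (value c)) λ m a<m m<k p q →
        between c (s m) (s-above a<m) (s-below k≢j k≢j′ m<k)
          (<-resp (sym w′a) (sym (s-value m)) p) (<-resp (sym (s-value m)) (sym w′k) q)

  cover-adjacent : ∀ k → Goal k
  cover-adjacent k = case k ≟ j of λ where
    (yes refl) → at-j
    (no k≢j) → case k ≟ j′ of λ where
      (yes refl) → at-j′
      (no k≢j′) → elsewhere k k≢j k≢j′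

-- After the exchange the value w(a) sits at `a′`, so its covers are now counted from there. The
-- value moved to `a` is larger than every later one: at `a′` it could never lie inside a rectangle
-- of `w` ending further right, and at `a` it forces the descent. The excluded index `a` corresponds
-- to the cover `w′` itself.
cover-lower : ∀ (w : Permutation′ n) {a a′ : Fin n} → Adjacent a a′ →
              (∀ m → a Fin.< m → m ≢ a′ → (w ⟨$⟩ʳ m) Fin.< (w ⟨$⟩ʳ a′)) → ∀ k → k ≢ a →
              let w′ = w ·t[ a , a′ ]; v′ = w′ ·t[ a′ , k ] in
              (Cover w a (τ a a′ k) → Cover w′ a′ k × (v′ ⟨$⟩ʳ a′) Fin.< (v′ ⟨$⟩ʳ a)) ×
              (Cover w′ a′ k → (v′ ⟨$⟩ʳ a′) Fin.< (v′ ⟨$⟩ʳ a) → Cover w a (τ a a′ k))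
cover-lower {n} w {a} {a′} adj maximal k k≢a = case k ≟ a′ of λ where
    (yes refl) → (λ c → ⊥-elim (ℕ.<-irrefl (cong toℕ (sym (τ-second a k))) (position c)))
               , (λ c _ → ⊥-elim (ℕ.<-irrefl refl (position c)))
    (no k≢a′) → elsewhere k≢a′
  where
  w′ = w ·t[ a , a′ ]
  v′ = w′ ·t[ a′ , k ]
  a<a′ = adjacent-< adj
  w′a′ : (w′ ⟨$⟩ʳ a′) ≡ (w ⟨$⟩ʳ a)
  w′a′ = cong (w ⟨$⟩ʳ_) (τ-second a a′)
  above : ∀ {m} → a′ Fin.< m → (w′ ⟨$⟩ʳ m) ≡ (w ⟨$⟩ʳ m)
  above a′<m = cong (w ⟨$⟩ʳ_) (τ-other a a′ (<⇒≢ (ℕ.<-trans a<a′ a′<m) ∘ sym) (<⇒≢ a′<m ∘ sym))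

  elsewhere : k ≢ a′ →
              (Cover w a (τ a a′ k) → Cover w′ a′ k × (v′ ⟨$⟩ʳ a′) Fin.< (v′ ⟨$⟩ʳ a)) ×
              (Cover w′ a′ k → (v′ ⟨$⟩ʳ a′) Fin.< (v′ ⟨$⟩ʳ a) → Cover w a (τ a a′ k))
  elsewhere k≢a′ rewrite τ-other a a′ k≢a k≢a′ = down , up
    where
    down : Cover w a k → Cover w′ a′ k × (v′ ⟨$⟩ʳ a′) Fin.< (v′ ⟨$⟩ʳ a)
    down c = cover a′<k (<-resp (sym w′a′) (sym (above a′<k)) (value c))
               (λ m a′<m m<k p q → between c m (ℕ.<-trans a<a′ a′<m) m<k
                  (<-resp w′a′ (above a′<m) p) (<-resp (above a′<m) (above a′<k) q))
           , <-resp (sym (trans (cong (w′ ⟨$⟩ʳ_) (τ-first a′ k)) (above a′<k)))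
                (sym (trans (cong (w′ ⟨$⟩ʳ_) (τ-other a′ k (<⇒≢ a<a′) (k≢a ∘ sym))) (cong (w ⟨$⟩ʳ_) (τ-first a a′))))
                (maximal k (position c) k≢a′)
      where a′<k = adjacent-above adj (position c) k≢a′
    up : Cover w′ a′ k → (v′ ⟨$⟩ʳ a′) Fin.< (v′ ⟨$⟩ʳ a) → Cover w a k
    up c _ = cover a<k (<-resp w′a′ (above (position c)) (value c)) between′
      where
      a<k = ℕ.<-trans a<a′ (position c)
      between′ : ∀ m → a Fin.< m → m Fin.< k → (w ⟨$⟩ʳ a) Fin.< (w ⟨$⟩ʳ m) → ¬ (w ⟨$⟩ʳ m) Fin.< (w ⟨$⟩ʳ k)
      between′ m a<m m<k p q = case m ≟ a′ of λ where
        (yes refl) → ℕ.<-asym q (maximal k a<k k≢a′)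
        (no m≢a′) → let a′<m = adjacent-above adj a<m m≢a′ in
          between c m a′<m m<k (<-resp (sym w′a′) (sym (above a′<m)) p) (<-resp (sym (above a′<m)) (sym (above (position c))) q)

-- Agreement with the longest permutation

AgreesBefore : Permutation′ n → Fin n → Set
AgreesBefore w a = ∀ k → k Fin.< a → (w ⟨$⟩ʳ k) ≡ opposite k

opposite-antimono-≤ : {i j : Fin n} → i Fin.≤ j → opposite j Fin.≤ opposite i
opposite-antimono-≤ {n} {i} {j} i≤j =
  subst₂ ℕ._≤_ (sym (opposite-prop j)) (sym (opposite-prop i)) (ℕ.∸-monoʳ-≤ n (s≤s i≤j))

module _ (w : Permutation′ n) {a : Fin n} (agrees : AgreesBefore w a) where

  -- All values above `opposite a` are used up by the positions before `a`.
  value-bound : ∀ {k} → a Fin.≤ k → (w ⟨$⟩ʳ k) Fin.≤ opposite a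
  value-bound {k} a≤k = subst (Fin._≤ opposite a) (opposite-involutive (w ⟨$⟩ʳ k)) (opposite-antimono-≤ a≤m)
    where
    m = opposite (w ⟨$⟩ʳ k)
    a≤m : a Fin.≤ m
    a≤m = ℕ.≮⇒≥ λ m<a → ℕ.<-irrefl
      (cong toℕ (permutation-injective w (trans (agrees m m<a) (opposite-involutive _))))
      (ℕ.<-≤-trans m<a a≤k)

  value-bound-strict : ∀ {k} → a Fin.≤ k → (w ⟨$⟩ʳ k) ≢ opposite a → (w ⟨$⟩ʳ k) Fin.< opposite a
  value-bound-strict a≤k wk≢ = ℕ.≤∧≢⇒< (value-bound a≤k) (wk≢ ∘ toℕ-injective)

  prefix-larger : ∀ {p k} → p Fin.< a → a Fin.≤ k → (w ⟨$⟩ʳ k) Fin.< (w ⟨$⟩ʳ p)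
  prefix-larger {p} {k} p<a a≤k = subst ((w ⟨$⟩ʳ k) Fin.<_) (sym (agrees p p<a))
    (ℕ.≤∧≢⇒< (ℕ.≤-trans (value-bound a≤k) (opposite-antimono-≤ (ℕ.<⇒≤ p<a)))
       λ eq → <⇒≢ (ℕ.<-≤-trans p<a a≤k)
                (permutation-injective w (trans (agrees p p<a) (sym (toℕ-injective eq)))))

  -- The value `opposite a` is the largest one left for the positions from `a` on, so it ends an
  -- ascent wherever it stands. The final equation is kept because it provides the maximality
  -- required by `cover-lower` when the ascent starts at `a`.
  ascent-after : (w ⟨$⟩ʳ a) ≢ opposite a →
                 ∃[ j ] ∃[ j′ ] (Adjacent j j′ × a Fin.≤ j × (w ⟨$⟩ʳ j) Fin.< (w ⟨$⟩ʳ j′) × (w ⟨$⟩ʳ j′) ≡ opposite a)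
  ascent-after wa≢ = j , p , adj , a≤j , subst ((w ⟨$⟩ʳ j) Fin.<_) (sym wp) (value-bound-strict a≤j wj≢) , wp
    where
    p = w ⟨$⟩ˡ opposite a
    wp : (w ⟨$⟩ʳ p) ≡ opposite a
    wp = inverseʳ w
    a<p : a Fin.< p
    a<p = ≮∧≢⇒> (λ p<a → <⇒≢ p<a (begin
              p                       ≡⟨ opposite-involutive p ⟨
              opposite (opposite p)   ≡⟨ cong opposite (trans (sym (agrees p p<a)) wp) ⟩
              opposite (opposite a)   ≡⟨ opposite-involutive a ⟩
              a                       ∎))
            (λ p≡a → wa≢ (trans (cong (w ⟨$⟩ʳ_) (sym p≡a)) wp))
    j = proj₁ (predecessor a<p)
    adj = proj₁ (proj₂ (predecessor a<p))
    a≤j = proj₂ (proj₂ (predecessor a<p))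
    wj≢ : (w ⟨$⟩ʳ j) ≢ opposite a
    wj≢ wj≡ = <⇒≢ (adjacent-< adj) (permutation-injective w (trans wj≡ (sym wp)))

search-least : ∀ {p} {P : Fin n → Set p} → Decidable P →
               (∀ k → ¬ P k) ⊎ ∃[ k ] (P k × (∀ m → m Fin.< k → ¬ P m))
search-least {zero} P? = inj₁ λ ()
search-least {suc n} P? with P? zero
... | yes P₀ = inj₂ (zero , P₀ , λ _ ())
... | no ¬P₀ with search-least (P? ∘ suc)
...   | inj₁ ¬P = inj₁ λ where
  zero → ¬P₀
  (suc k) → ¬P k
...   | inj₂ (k , Pk , least) = inj₂ (suc k , Pk , λ where
  zero _ → ¬P₀
  (suc m) (s≤s m<k) → least m m<k)

first-difference : ∀ (w : Permutation′ n) →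
                   (w Perm.≈ reverse) ⊎ ∃[ a ] (AgreesBefore w a × (w ⟨$⟩ʳ a) ≢ opposite a)
first-difference w with search-least (λ k → ¬? ((w ⟨$⟩ʳ k) ≟ opposite k))
... | inj₁ agree = inj₁ λ k → case (w ⟨$⟩ʳ k) ≟ opposite k of λ where
  (yes eq) → eq
  (no neq) → ⊥-elim (agree k neq)
... | inj₂ (a , wa≢ , least) = inj₂ (a , agrees , wa≢)
  where
  agrees : AgreesBefore w a
  agrees k k<a = case (w ⟨$⟩ʳ k) ≟ opposite k of λ where
    (yes eq) → eq
    (no neq) → ⊥-elim (least k k<a neq)

-- The transition formula

staircase : Monomial n
staircase {n} = tabulate (λ k → n ∸ suc (toℕ k))

-- Consecutive exponents of the staircase differ by one, and the extra x_a′ evens them out.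
staircase-symmetric : ∀ {a a′ : Fin n} → Adjacent a a′ → swap a a′ (x a′ · staircase) ≡ x a′ · staircase
staircase-symmetric {n} {a} {a′} adj = lookup-extensional λ k →
  trans (lookup-swap a a′ _ k) (case k ≟ a of λ where
    (yes refl) → trans (cong (lookup m) (τ-first k a′)) (sym balanced)
    (no k≢a) → case k ≟ a′ of λ where
      (yes refl) → trans (cong (lookup m) (τ-second a k)) balanced
      (no k≢a′) → cong (lookup m) (τ-other a a′ k≢a k≢a′))
  where
  m = x a′ · staircase
  balanced : lookup m a ≡ lookup m a′
  balanced = begin
    lookup m a                          ≡⟨ cong (λ u → lookup u a) (·-comm (x a′) staircase) ⟩
    lookup (staircase · x a′) a         ≡⟨ lookup-·x-other staircase (<⇒≢ (adjacent-< adj)) ⟩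
    lookup staircase a                  ≡⟨ lookup∘tabulate _ a ⟩
    -- Since `a′` is an index too, this difference is positive and its predecessor is not truncated.
    n ∸ suc (toℕ a)                     ≡⟨ ℕ.suc-pred (n ∸ suc (toℕ a)) ⦃ ℕ.>-nonZero (ℕ.m<n⇒0<n∸m (subst (ℕ._< n) adj (toℕ<n a′))) ⦄ ⟨
    suc (ℕ.pred (n ∸ suc (toℕ a)))      ≡⟨ cong suc (ℕ.pred[m∸n]≡m∸[1+n] n (suc (toℕ a))) ⟩
    suc (n ∸ suc (suc (toℕ a)))         ≡⟨ cong (λ p → suc (n ∸ suc p)) adj ⟨
    suc (n ∸ suc (toℕ a′))              ≡⟨ cong suc (lookup∘tabulate _ a′) ⟨
    suc (lookup staircase a′)           ≡⟨ lookup-·x-same staircase a′ ⟨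
    lookup (staircase · x a′) a′        ≡⟨ cong (λ u → lookup u a′) (·-comm staircase (x a′)) ⟩
    lookup m a′                         ∎

module Schubert (𝔖 : Permutation′ n → Polynomial n) (isSchubert : IsSchubertFamily 𝔖) where

  open IsSchubertFamily isSchubert

  S : Permutation′ n → Series n
  S w = coeff (𝔖 w)

  S-∂ : ∀ (w : Permutation′ n) {i j} → Adjacent i j → (w ⟨$⟩ʳ i) Fin.< (w ⟨$⟩ʳ j) →
        S (w ·t[ i , j ]) ∂[ i , j ] S w
  S-∂ w {i} {j} adj ascent = ∂-coeff {f = 𝔖 (w ·t[ i , j ])} {𝔖 w} (recursion w i j adj ascent)

  S-∂-descent : ∀ (w : Permutation′ n) {i j} → Adjacent i j → (w ⟨$⟩ʳ j) Fin.< (w ⟨$⟩ʳ i) →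
                S w ∂[ i , j ] S (w ·t[ i , j ])
  S-∂-descent w {i} {j} adj descent =
    ∂-resp (respects {w ·t[ i , j ] ·t[ i , j ]} {w} λ k → cong (w ⟨$⟩ʳ_) (τ-involutive i j k)) (λ _ → refl)
      (S-∂ (w ·t[ i , j ]) adj (subst₂ Fin._<_ (cong (w ⟨$⟩ʳ_) (sym (τ-first i j))) (cong (w ⟨$⟩ʳ_) (sym (τ-second i j))) descent))

  -- At an ascent 𝔖_w is itself a divided difference, hence symmetric in the two variables.
  S-∂-ascent : ∀ (w : Permutation′ n) {i j} → Adjacent i j → (w ⟨$⟩ʳ i) Fin.< (w ⟨$⟩ʳ j) →
               S w ∂[ i , j ] (λ _ → 0ℤ)
  S-∂-ascent w adj ascent = ∂-symmetric (∂-result-symmetric (<⇒≢ (adjacent-< adj)) (S-∂ w adj ascent))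

  -- Padded with zeros to all positions, so that the sum can be reindexed by a transposition and
  -- differentiated term by term.
  term : Permutation′ n → Fin n → Fin n → Series n
  term w a k v = if does (cover? w a k) then S (w ·t[ a , k ]) v else 0ℤ

  term-cover : ∀ {w a k} → Cover w a k → term w a k ≗ S (w ·t[ a , k ])
  term-cover {w} {a} {k} c v = cong (if_then S (w ·t[ a , k ]) v else 0ℤ) (dec-true (cover? w a k) c)

  term-¬cover : ∀ {w a k} → ¬ Cover w a k → term w a k ≗ (λ _ → 0ℤ)
  term-¬cover {w} {a} {k} ¬c v = cong (if_then S (w ·t[ a , k ]) v else 0ℤ) (dec-false (cover? w a k) ¬c)

  term-∂ : ∀ {i j : Fin n} {w a k w′ b l} → Adjacent i j →
           (w′ ·t[ b , l ] ·t[ i , j ]) Perm.≈ (w ·t[ a , k ]) →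
           (Cover w a k → Cover w′ b l × (w′ ·t[ b , l ] ⟨$⟩ʳ j) Fin.< (w′ ·t[ b , l ] ⟨$⟩ʳ i)) ×
           (Cover w′ b l → (w′ ·t[ b , l ] ⟨$⟩ʳ j) Fin.< (w′ ·t[ b , l ] ⟨$⟩ʳ i) → Cover w a k) →
           term w′ b l ∂[ i , j ] term w a k
  term-∂ {i} {j} {w} {a} {k} {w′} {b} {l} adj v≈ (down , up) = case cover? w′ b l of λ where
    (no ¬c) → ∂-resp (sym ∘ term-¬cover ¬c) (sym ∘ term-¬cover (¬c ∘ proj₁ ∘ down)) (∂-symmetric λ _ → refl)
    (yes c) → case ((w′ ·t[ b , l ]) ⟨$⟩ʳ j) <? ((w′ ·t[ b , l ]) ⟨$⟩ʳ i) of λ where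
      (yes descent) → ∂-resp (sym ∘ term-cover c) (λ v → trans (respects {w′ ·t[ b , l ] ·t[ i , j ]} {w ·t[ a , k ]} v≈ v) (sym (term-cover (up c descent) v)))
                        (S-∂-descent (w′ ·t[ b , l ]) adj descent)
      (no ¬descent) → ∂-resp (sym ∘ term-cover c) (sym ∘ term-¬cover (¬descent ∘ proj₂ ∘ down))
                        (S-∂-ascent (w′ ·t[ b , l ]) adj (≮∧≢⇒> ¬descent
                          (<⇒≢ (adjacent-< adj) ∘ sym ∘ permutation-injective (w′ ·t[ b , l ]))))

  Transition : Permutation′ n → Fin n → Set
  Transition w a = shift a (S w) ≗ (λ v → ∑ℤ.sum (λ k → term w a k v))

  -- Multiplication by x_a commutes with this divided difference because `a` is neither `j` nor
  -- `j′`. Applied to both sides of the formula for w t_jj′, it gives two results that must agree by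
  -- uniqueness.
  transition-right : ∀ {w a j j′} → Adjacent j j′ → a Fin.< j → (w ⟨$⟩ʳ j) Fin.< (w ⟨$⟩ʳ j′) →
                     Transition (w ·t[ j , j′ ]) a → Transition w a
  transition-right {w} {a} {j} {j′} adj a<j ascent transition v = begin
    shift a (S w) v                               ≡⟨ ∂-unique (<⇒≢ (adjacent-< adj))
                                                       (∂-shift-other a≢j a≢j′ (S-∂ w adj ascent))
                                                       (∂-sum (term (w ·t[ j , j′ ]) a) (λ k → term w a (τ j j′ k)) term-∂′) transition v ⟩
    ∑ℤ.sum (λ k → term w a (τ j j′ k) v)          ≡⟨ ∑ℤ.sum-permute (λ k → term w a k v) (transpose j j′) ⟨
    ∑ℤ.sum (λ k → term w a k v)                   ∎
    where
    a≢j = <⇒≢ a<j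
    a≢j′ = <⇒≢ (ℕ.<-trans a<j (adjacent-< adj))
    term-∂′ : ∀ k → term (w ·t[ j , j′ ]) a k ∂[ j , j′ ] term w a (τ j j′ k)
    term-∂′ k = term-∂ adj
      (λ m → cong (w ⟨$⟩ʳ_) (trans (τ-conjugate j j′ a k m) (cong (λ b → τ b (τ j j′ k) m) (τ-other j j′ a≢j a≢j′))))
      (cover-adjacent w adj a<j ascent k)

  -- By the Leibniz rule the divided difference of x_a′ 𝔖_w′ is x_a 𝔖_w - 𝔖_w′. `R` is the same
  -- divided difference evaluated in another way, and the missing 𝔖_w′ is the term for the cover at
  -- `a′`.
  transition-left : ∀ {w a a′} → Adjacent a a′ → (w ⟨$⟩ʳ a) Fin.< (w ⟨$⟩ʳ a′) → (R : Series n) →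
                    shift a′ (S (w ·t[ a , a′ ])) ∂[ a , a′ ] R →
                    (∀ v → ∑ℤ.sum (λ k → term w a k v) ≡ R v ℤ.+ S (w ·t[ a , a′ ]) v) → Transition w a
  transition-left {w} {a} {a′} adj ascent R ∂R sum≡ v = begin
    shift a (S w) v                                 ≡⟨ split (shift a (S w) v) (S w′ v) ⟩
    (shift a (S w) v ℤ.- S w′ v) ℤ.+ S w′ v         ≡⟨ cong (ℤ._+ S w′ v) (∂-unique (<⇒≢ (adjacent-< adj))
                                                         (∂-shift-second (S-∂ w adj ascent)) ∂R (λ _ → refl) v) ⟩
    R v ℤ.+ S w′ v                                  ≡⟨ sum≡ v ⟨
    ∑ℤ.sum (λ k → term w a k v)                     ∎
    where
    w′ = w ·t[ a , a′ ]
    split : ∀ p q → p ≡ (p ℤ.- q) ℤ.+ q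
    split = solve-∀

  module _ {w : Permutation′ n} {a a′} (adj : Adjacent a a′) (ascent : (w ⟨$⟩ʳ a) Fin.< (w ⟨$⟩ʳ a′)) where

    private
      w′ = w ·t[ a , a′ ]

      cover-next : Cover w a a′
      cover-next = cover (adjacent-< adj) ascent λ m a<m m<a′ _ _ →
        ℕ.<-irrefl refl (ℕ.<-≤-trans m<a′ (subst (ℕ._≤ toℕ m) (sym adj) a<m))

    transition-base : w′ Perm.≈ reverse → Transition w a
    transition-base w′≈ = transition-left {w = w} adj ascent (λ _ → 0ℤ) (∂-symmetric symmetric) single
      where
      S-reverse : S w′ ≗ coeff ⟦ staircase ⟧
      S-reverse v = trans (respects {w′} {reverse} w′≈ v) (longest v)
      symmetric : shift a′ (S w′) ≗ shift a′ (S w′) ∘ swap a a′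
      symmetric v = trans (shift-cong a′ S-reverse v)
        (trans (shift-monomial-symmetric a a′ staircase (staircase-symmetric adj) v)
               (sym (shift-cong a′ S-reverse (swap a a′ v))))
      -- Beyond `a′` the values are those of w₀, and they lie below w₀(a′), which is w(a).
      no-cover : ∀ {k} → k ≢ a′ → ¬ Cover w a k
      no-cover {k} k≢a′ c = ℕ.<⇒≱ (value c) (subst₂ Fin._≤_
          (trans (sym (w′≈ k)) (cong (w ⟨$⟩ʳ_) (τ-other a a′ (<⇒≢ (position c) ∘ sym) k≢a′)))
          (trans (sym (w′≈ a′)) (cong (w ⟨$⟩ʳ_) (τ-second a a′)))
          (opposite-antimono-≤ (ℕ.<⇒≤ (adjacent-above adj (position c) k≢a′))))
      single : ∀ v → ∑ℤ.sum (λ k → term w a k v) ≡ 0ℤ ℤ.+ S w′ v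
      single v = begin
        ∑ℤ.sum (λ k → term w a k v)             ≡⟨ ℤ.+-identityʳ _ ⟨
        ∑ℤ.sum (λ k → term w a k v) ℤ.+ 0ℤ      ≡⟨ sum-update ℤ.+-0-commutativeMonoid (λ k → term w a k v) (λ _ → 0ℤ) a′
                                                      (λ k k≢a′ → term-¬cover (no-cover k≢a′) v) ⟩
        ∑ℤ.sum {n} (λ _ → 0ℤ) ℤ.+ term w a a′ v ≡⟨ cong₂ ℤ._+_ (∑ℤ.sum-replicate-zero n) (term-cover cover-next v) ⟩
        0ℤ ℤ.+ S w′ v                           ∎

    transition-lower : (∀ m → a Fin.< m → m ≢ a′ → (w ⟨$⟩ʳ m) Fin.< (w ⟨$⟩ʳ a′)) →
                       Transition w′ a′ → Transition w a
    transition-lower maximal transition = transition-left {w = w} adj ascent (λ v → ∑ℤ.sum (λ k → rest k v))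
      (∂-resp (sym ∘ transition) (λ _ → refl) (∂-sum (term w′ a′) rest rest-∂)) sum≡
      where
      -- The index `a` is blanked out: the transposition sends it to `a′`, whose term is 𝔖_w′. That
      -- term comes from the Leibniz rule and has no counterpart among the covers of `w′` at `a′`.
      rest : Fin n → Series n
      rest k v = if does (k ≟ a) then 0ℤ else term w a (τ a a′ k) v
      rest-a : ∀ v → rest a v ≡ 0ℤ
      rest-a v = cong (if_then 0ℤ else term w a (τ a a′ a) v) (dec-true (a ≟ a) refl)
      rest-other : ∀ {k} → k ≢ a → rest k ≗ term w a (τ a a′ k)
      rest-other {k} k≢a v = cong (if_then 0ℤ else term w a (τ a a′ k) v) (dec-false (k ≟ a) k≢a)
      rest-∂ : ∀ k → term w′ a′ k ∂[ a , a′ ] rest k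
      rest-∂ k = case k ≟ a of λ where
        (yes refl) → ∂-resp (sym ∘ term-¬cover {w = w′} (λ c → ℕ.<-asym (position c) (adjacent-< adj))) (sym ∘ rest-a)
                       (∂-symmetric λ _ → refl)
        (no k≢a) → ∂-resp (λ _ → refl) (sym ∘ rest-other k≢a) (term-∂ adj
          (λ m → cong (w ⟨$⟩ʳ_) (trans (τ-conjugate a a′ a′ k m) (cong (λ b → τ b (τ a a′ k) m) (τ-second a a′))))
          (cover-lower w adj maximal k k≢a))
      sum≡ : ∀ v → ∑ℤ.sum (λ k → term w a k v) ≡ ∑ℤ.sum (λ k → rest k v) ℤ.+ S w′ v
      sum≡ v = begin
        ∑ℤ.sum (λ k → term w a k v)                                   ≡⟨ ∑ℤ.sum-permute (λ k → term w a k v) (transpose a a′) ⟩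
        ∑ℤ.sum (λ k → term w a (τ a a′ k) v)                          ≡⟨ ℤ.+-identityʳ _ ⟨
        ∑ℤ.sum (λ k → term w a (τ a a′ k) v) ℤ.+ 0ℤ                   ≡⟨ cong (λ c → ∑ℤ.sum (λ k → term w a (τ a a′ k) v) ℤ.+ c) (rest-a v) ⟨
        ∑ℤ.sum (λ k → term w a (τ a a′ k) v) ℤ.+ rest a v             ≡⟨ sum-update ℤ.+-0-commutativeMonoid (λ k → term w a (τ a a′ k) v) (λ k → rest k v) a
                                                                            (λ k k≢a → sym (rest-other k≢a v)) ⟩
        ∑ℤ.sum (λ k → rest k v) ℤ.+ term w a (τ a a′ a) v             ≡⟨ cong (λ k → ∑ℤ.sum (λ l → rest l v) ℤ.+ term w a k v) (τ-first a a′) ⟩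
        ∑ℤ.sum (λ k → rest k v) ℤ.+ term w a a′ v                     ≡⟨ cong (λ c → ∑ℤ.sum (λ k → rest k v) ℤ.+ c) (term-cover cover-next v) ⟩
        ∑ℤ.sum (λ k → rest k v) ℤ.+ S w′ v                            ∎

  transition : ∀ w a → AgreesBefore w a → (w ⟨$⟩ʳ a) ≢ opposite a → Transition w a
  transition w a agrees wa≢ = go w a agrees wa≢ (<-wellFounded (coinversion w))
    where
    go : ∀ w a → AgreesBefore w a → (w ⟨$⟩ʳ a) ≢ opposite a → Acc ℕ._<_ (coinversion w) → Transition w a
    go w a agrees wa≢ (acc rec) with ascent-after w agrees wa≢
    ... | j , j′ , adj , a≤j , ascent , wj′ = case a ≟ j of λ where
        (no a≢j) → right adj (ℕ.≤∧≢⇒< a≤j (a≢j ∘ toℕ-injective)) ascent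
        (yes refl) → left adj ascent wj′
      where
      right : ∀ {j j′} → Adjacent j j′ → a Fin.< j → (w ⟨$⟩ʳ j) Fin.< (w ⟨$⟩ʳ j′) → Transition w a
      right {j} {j′} adj a<j ascent = transition-right {w = w} adj a<j ascent
        (go (w ·t[ j , j′ ]) a (λ k k<a → trans (fixed (ℕ.<⇒≤ k<a)) (agrees k k<a))
            (wa≢ ∘ trans (sym (fixed ℕ.≤-refl))) (rec (coinversion-step w (adjacent-< adj) ascent)))
        where
        fixed : ∀ {k} → k Fin.≤ a → (w ·t[ j , j′ ] ⟨$⟩ʳ k) ≡ (w ⟨$⟩ʳ k)
        fixed k≤a = cong (w ⟨$⟩ʳ_) (τ-other j j′ (<⇒≢ k<j) (<⇒≢ (ℕ.<-trans k<j (adjacent-< adj))))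
          where k<j = ℕ.≤-<-trans k≤a a<j

      left : ∀ {a′} → Adjacent a a′ → (w ⟨$⟩ʳ a) Fin.< (w ⟨$⟩ʳ a′) → (w ⟨$⟩ʳ a′) ≡ opposite a → Transition w a
      left {a′} adj ascent wa′ with first-difference (w ·t[ a , a′ ])
      ... | inj₁ w′≈ = transition-base {w = w} adj ascent w′≈
      ... | inj₂ (b , agrees′ , w′b≢) = case a′ ≟ b of λ where
          (yes refl) → transition-lower {w = w} adj ascent maximal
                         (go w′ b agrees′ w′b≢ (rec (coinversion-step w (adjacent-< adj) ascent)))
          -- Now `w′` agrees with w₀ at `a′` as well, so the induction hypothesis says nothing
          -- there. But `w′` has an ascent further right, where it coincides with `w`, and the step
          -- to the right applies to `w` instead.
          (no a′≢b) → later (ascent-after w′ agrees′ w′b≢) (adjacent-above adj a<b (a′≢b ∘ sym))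
        where
        w′ = w ·t[ a , a′ ]
        maximal : ∀ m → a Fin.< m → m ≢ a′ → (w ⟨$⟩ʳ m) Fin.< (w ⟨$⟩ʳ a′)
        maximal m a<m m≢a′ = subst ((w ⟨$⟩ʳ m) Fin.<_) (sym wa′) (value-bound-strict w agrees (ℕ.<⇒≤ a<m)
          λ wm → m≢a′ (permutation-injective w (trans wm (sym wa′))))
        a<b : a Fin.< b
        a<b = ≮∧≢⇒>
          (λ b<a → w′b≢ (trans (cong (w ⟨$⟩ʳ_) (τ-other a a′ (<⇒≢ b<a) (<⇒≢ (ℕ.<-trans b<a (adjacent-< adj))))) (agrees b b<a)))
          (λ b≡a → w′b≢ (subst (λ c → (w′ ⟨$⟩ʳ c) ≡ opposite c) (sym b≡a) (trans (cong (w ⟨$⟩ʳ_) (τ-first a a′)) wa′)))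
        later : ∃[ j ] ∃[ j′ ] (Adjacent j j′ × b Fin.≤ j × (w′ ⟨$⟩ʳ j) Fin.< (w′ ⟨$⟩ʳ j′) × (w′ ⟨$⟩ʳ j′) ≡ opposite b) →
                a′ Fin.< b → Transition w a
        later (j , j′ , adj′ , b≤j , ascent′ , _) a′<b =
          right adj′ (ℕ.<-trans (adjacent-< adj) a′<j)
            (subst₂ Fin._<_ (unchanged a′<j) (unchanged (ℕ.<-trans a′<j (adjacent-< adj′))) ascent′)
          where
          a′<j = ℕ.<-≤-trans a′<b b≤j
          unchanged : ∀ {k} → a′ Fin.< k → (w′ ⟨$⟩ʳ k) ≡ (w ⟨$⟩ʳ k)
          unchanged a′<k = cong (w ⟨$⟩ʳ_) (τ-other a a′ (<⇒≢ (ℕ.<-trans (adjacent-< adj) a′<k) ∘ sym) (<⇒≢ a′<k ∘ sym))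

-- Counting

module _ {p} {P : Set p} where

  indicator : Dec P → ℕ
  indicator P? = if does P? then 1 else 0

  indicator-true : (P? : Dec P) → P → indicator P? ≡ 1
  indicator-true P? p = cong (if_then 1 else 0) (dec-true P? p)

  indicator-false : (P? : Dec P) → ¬ P → indicator P? ≡ 0
  indicator-false P? ¬p = cong (if_then 1 else 0) (dec-false P? ¬p)

indicator-mono : ∀ {p q} {P : Set p} {Q : Set q} (P? : Dec P) (Q? : Dec Q) →
                 (P → Q) → indicator P? ℕ.≤ indicator Q?
indicator-mono (yes p) Q? P⇒Q = ℕ.≤-reflexive (sym (indicator-true Q? (P⇒Q p)))
indicator-mono (no _) Q? P⇒Q = z≤n

indicator-cong : ∀ {p q} {P : Set p} {Q : Set q} (P? : Dec P) (Q? : Dec Q) →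
                 (P → Q) → (Q → P) → indicator P? ≡ indicator Q?
indicator-cong P? Q? P⇒Q Q⇒P = ℕ.≤-antisym (indicator-mono P? Q? P⇒Q) (indicator-mono Q? P? Q⇒P)

sum-mono-≤ : ∀ {f g : Fin n → ℕ} → (∀ k → f k ℕ.≤ g k) → ∑ℕ.sum f ℕ.≤ ∑ℕ.sum g
sum-mono-≤ {zero} f≤g = z≤n
sum-mono-≤ {suc n} f≤g = ℕ.+-mono-≤ (f≤g zero) (sum-mono-≤ (f≤g ∘ suc))

count-below : ∀ {m} → m ℕ.≤ n → ∑ℕ.sum {n} (λ p → indicator (toℕ p ℕ.<? m)) ≡ m
count-below {zero} z≤n = refl
count-below {suc n} {zero} _ = ∑ℕ.sum-replicate-zero (suc n)
count-below {suc n} {suc m} (s≤s m≤n) = cong suc (trans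
  (∑ℕ.sum-cong-≗ {n} λ p → indicator-cong (suc (toℕ p) ℕ.<? suc m) (toℕ p ℕ.<? m) ℕ.≤-pred s≤s)
  (count-below m≤n))

count-above : ∀ n m → ∑ℕ.sum {n} (λ p → indicator (m ℕ.<? toℕ p)) ≡ n ∸ suc m
count-above zero m = refl
count-above (suc n) zero = count-positive n
  where
  count-positive : ∀ n → ∑ℕ.sum {n} (λ p → indicator (0 ℕ.<? suc (toℕ p))) ≡ n
  count-positive zero = refl
  count-positive (suc n) = cong suc (count-positive n)
count-above (suc n) (suc m) = trans
  (∑ℕ.sum-cong-≗ {n} λ p → indicator-cong (suc m ℕ.<? suc (toℕ p)) (m ℕ.<? toℕ p) ℕ.≤-pred s≤s)
  (count-above n m)

-- The leading exponent

largerBefore? : ∀ (w : Permutation′ n) k p → Dec (p Fin.< k × (w ⟨$⟩ʳ k) Fin.< (w ⟨$⟩ʳ p))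
largerBefore? w k p = (p <? k) ×-dec ((w ⟨$⟩ʳ k) <? (w ⟨$⟩ʳ p))

largerBefore : Permutation′ n → Fin n → ℕ
largerBefore w k = ∑ℕ.sum (λ p → indicator (largerBefore? w k p))

-- The number of larger values to the left of k is the entry of w k in the
-- code of w⁻¹; the leading exponent is the partition conjugate to that code.
top : Permutation′ n → Monomial n
top w = tabulate λ i → ∑ℕ.sum (λ k → indicator (toℕ i ℕ.<? largerBefore w k))

largerBefore-≤ : ∀ (w : Permutation′ n) k → largerBefore w k ℕ.≤ toℕ k
largerBefore-≤ w k = subst (largerBefore w k ℕ.≤_) (count-below (ℕ.<⇒≤ (toℕ<n k)))
  (sum-mono-≤ λ p → indicator-mono (largerBefore? w k p) (toℕ p ℕ.<? toℕ k) proj₁)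

-- Each position before `a` is counted. This gives l ≥ a for the variable x_l gained in a cover,
-- hence x_l ≼ x_a.
largerBefore-≥ : ∀ (w : Permutation′ n) {a k} → AgreesBefore w a → a Fin.≤ k → toℕ a ℕ.≤ largerBefore w k
largerBefore-≥ w {a} {k} agrees a≤k = subst (ℕ._≤ largerBefore w k) (count-below (ℕ.<⇒≤ (toℕ<n a)))
  (sum-mono-≤ λ p → indicator-mono (toℕ p ℕ.<? toℕ a) (largerBefore? w k p)
    λ p<a → ℕ.<-≤-trans p<a a≤k , prefix-larger w agrees p<a a≤k)

-- The positions from `a` up to `b` hold values at most w(a), so only the prefix before `a` is
-- counted; this is the equality case of the previous bound.
largerBefore-first : ∀ (w : Permutation′ n) {a b} → AgreesBefore w a → a Fin.< b → (w ⟨$⟩ʳ a) Fin.< (w ⟨$⟩ʳ b) →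
                     (∀ m → a Fin.< m → m Fin.< b → (w ⟨$⟩ʳ m) Fin.< (w ⟨$⟩ʳ a)) → largerBefore w b ≡ toℕ a
largerBefore-first w {a} {b} agrees a<b wa<wb smaller = trans
  (∑ℕ.sum-cong-≗ λ p → indicator-cong (largerBefore? w b p) (toℕ p ℕ.<? toℕ a)
    (λ (p<b , wb<wp) → ≮∧≢⇒> (λ a<p → ℕ.<-asym (ℕ.<-trans (smaller p a<p p<b) wa<wb) wb<wp)
                             (λ { refl → ℕ.<-asym wa<wb wb<wp }))
    (λ p<a → ℕ.<-trans p<a a<b , prefix-larger w agrees p<a (ℕ.<⇒≤ a<b)))
  (count-below (ℕ.<⇒≤ (toℕ<n a)))

top-reverse : ∀ {w : Permutation′ n} → w Perm.≈ reverse → top w ≡ staircase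
top-reverse {n} {w} w≈ = lookup-extensional λ i → begin
  lookup (top w) i                                              ≡⟨ lookup∘tabulate _ i ⟩
  ∑ℕ.sum (λ k → indicator (toℕ i ℕ.<? largerBefore w k))        ≡⟨ ∑ℕ.sum-cong-≗ (λ k → cong (λ m → indicator (toℕ i ℕ.<? m)) (position-count k)) ⟩
  ∑ℕ.sum {n} (λ k → indicator (toℕ i ℕ.<? toℕ k))               ≡⟨ count-above n (toℕ i) ⟩
  n ∸ suc (toℕ i)                                               ≡⟨ lookup∘tabulate _ i ⟨
  lookup staircase i                                            ∎
  where
  position-count : ∀ k → largerBefore w k ≡ toℕ k
  position-count k = ℕ.≤-antisym (largerBefore-≤ w k) (largerBefore-≥ w (λ m _ → w≈ m) ℕ.≤-refl)

module _ (w : Permutation′ n) {a k : Fin n} (agrees : AgreesBefore w a) (c : Cover w a k) where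

  private
    v = w ·t[ a , k ]
    a<k = position c

    v-a : (v ⟨$⟩ʳ a) ≡ (w ⟨$⟩ʳ k)
    v-a = cong (w ⟨$⟩ʳ_) (τ-first a k)
    v-k : (v ⟨$⟩ʳ k) ≡ (w ⟨$⟩ʳ a)
    v-k = cong (w ⟨$⟩ʳ_) (τ-second a k)
    v-other : ∀ {p} → p ≢ a → p ≢ k → (v ⟨$⟩ʳ p) ≡ (w ⟨$⟩ʳ p)
    v-other p≢a p≢k = cong (w ⟨$⟩ʳ_) (τ-other a k p≢a p≢k)

    value-gap : ∀ {m} → a Fin.< m → m Fin.< k → (w ⟨$⟩ʳ m) Fin.< (w ⟨$⟩ʳ k) → (w ⟨$⟩ʳ m) Fin.< (w ⟨$⟩ʳ a)
    value-gap a<m m<k wm<wk = ≮∧≢⇒> (λ wa<wm → between c _ a<m m<k wa<wm wm<wk)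
                                     (<⇒≢ a<m ∘ permutation-injective w)

    at-a : largerBefore v a ≡ largerBefore w a
    at-a = ∑ℕ.sum-cong-≗ λ p → indicator-cong (largerBefore? v a p) (largerBefore? w a p)
      (λ (p<a , _) → p<a , prefix-larger w agrees p<a ℕ.≤-refl)
      (λ (p<a , _) → p<a , <-resp (sym v-a) (sym (v-other (<⇒≢ p<a) (<⇒≢ (ℕ.<-trans p<a a<k))))
                             (prefix-larger w agrees p<a (ℕ.<⇒≤ a<k)))

    -- A position after `k` sees both exchanged values, and their contributions trade places. A
    -- position between `a` and `k` sees only the one at `a`, and its own value does not lie between
    -- the old and the new one.
    elsewhere : ∀ {q} → q ≢ a → q ≢ k → largerBefore v q ≡ largerBefore w q
    elsewhere {q} q≢a q≢k = ℕ.+-cancelʳ-≡ (before a ℕ.+ before k) _ _ (trans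
      (sum-update₂ after before (<⇒≢ a<k) (λ p p≢a p≢k → indicator-cong (largerBefore? v q p) (largerBefore? w q p)
        (λ (p<q , <vp) → p<q , <-resp vq (v-other p≢a p≢k) <vp)
        (λ (p<q , <wp) → p<q , <-resp (sym vq) (sym (v-other p≢a p≢k)) <wp)))
      (cong (largerBefore w q ℕ.+_) balanced))
      where
      after before : Fin n → ℕ
      after p = indicator (largerBefore? v q p)
      before p = indicator (largerBefore? w q p)
      vq = v-other q≢a q≢k

      balanced : after a ℕ.+ after k ≡ before a ℕ.+ before k
      balanced = case k <? q of λ where
        (yes k<q) → trans (ℕ.+-comm (after a) (after k)) (cong₂ ℕ._+_
          (indicator-cong (largerBefore? v q k) (largerBefore? w q a)
            (λ (_ , <vk) → ℕ.<-trans a<k k<q , <-resp vq v-k <vk)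
            (λ (_ , <wa) → k<q , <-resp (sym vq) (sym v-k) <wa))
          (indicator-cong (largerBefore? v q a) (largerBefore? w q k)
            (λ (_ , <va) → k<q , <-resp vq v-a <va)
            (λ (_ , <wk) → ℕ.<-trans a<k k<q , <-resp (sym vq) (sym v-a) <wk)))
        (no k≮q) → cong₂ ℕ._+_
          (indicator-cong (largerBefore? v q a) (largerBefore? w q a)
            (λ (a<q , <va) → a<q , value-gap a<q (≮∧≢⇒> k≮q (q≢k ∘ sym)) (<-resp vq v-a <va))
            (λ (a<q , <wa) → a<q , <-resp (sym vq) (sym v-a) (ℕ.<-trans <wa (value c))))
          (trans (indicator-false (largerBefore? v q k) (k≮q ∘ proj₁))
                 (sym (indicator-false (largerBefore? w q k) (k≮q ∘ proj₁))))

  largerBefore-cover-other : ∀ q → q ≢ k → largerBefore v q ≡ largerBefore w q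
  largerBefore-cover-other q q≢k = case q ≟ a of λ where
    (yes refl) → at-a
    (no q≢a) → elsewhere q≢a q≢k

  -- Position `a` now counts at `k`. Nothing else changes: no position between them has a value
  -- strictly between w(a) and w(k), and the prefix was counted already.
  largerBefore-cover : largerBefore v k ≡ suc (largerBefore w k)
  largerBefore-cover = begin
    largerBefore v k                                              ≡⟨ ℕ.+-identityʳ _ ⟨
    largerBefore v k ℕ.+ 0                                        ≡⟨ cong (largerBefore v k ℕ.+_) (indicator-false (largerBefore? w k a) (ℕ.<-asym (value c) ∘ proj₂)) ⟨
    largerBefore v k ℕ.+ indicator (largerBefore? w k a)          ≡⟨ sum-update ℕ.+-0-commutativeMonoid
                                                                       (λ p → indicator (largerBefore? v k p)) (λ p → indicator (largerBefore? w k p)) a same ⟩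
    largerBefore w k ℕ.+ indicator (largerBefore? v k a)          ≡⟨ cong (largerBefore w k ℕ.+_) (indicator-true (largerBefore? v k a) (a<k , <-resp (sym v-k) (sym v-a) (value c))) ⟩
    largerBefore w k ℕ.+ 1                                        ≡⟨ ℕ.+-comm _ 1 ⟩
    suc (largerBefore w k)                                        ∎
    where
    same : ∀ p → p ≢ a → indicator (largerBefore? v k p) ≡ indicator (largerBefore? w k p)
    same p p≢a = indicator-cong (largerBefore? v k p) (largerBefore? w k p)
      (λ (p<k , vk<vp) → p<k , larger p<k (<-resp v-k (v-other p≢a (<⇒≢ p<k)) vk<vp))
      (λ (p<k , wk<wp) → p<k , <-resp (sym v-k) (sym (v-other p≢a (<⇒≢ p<k))) (ℕ.<-trans (value c) wk<wp))
      where
      larger : p Fin.< k → (w ⟨$⟩ʳ a) Fin.< (w ⟨$⟩ʳ p) → (w ⟨$⟩ʳ k) Fin.< (w ⟨$⟩ʳ p)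
      larger p<k wa<wp = case a <? p of λ where
        (yes a<p) → ≮∧≢⇒> (between c p a<p p<k wa<wp) (<⇒≢ p<k ∘ permutation-injective w)
        (no a≮p) → prefix-larger w agrees (≮∧≢⇒> a≮p (p≢a ∘ sym)) (ℕ.<⇒≤ a<k)

  -- Increasing one part of the code from l to l + 1 adds a box in column l, counted from 0, and
  -- conjugation turns columns into exponents.
  top-cover : ∀ l → toℕ l ≡ largerBefore w k → top v ≡ top w · x l
  top-cover l l≡ = lookup-extensional λ i → begin
    lookup (top v) i                      ≡⟨ lookup∘tabulate _ i ⟩
    ∑ℕ.sum (count v i)                    ≡⟨ ℕ.+-cancelʳ-≡ (count w i k) _ _ (begin
      ∑ℕ.sum (count v i) ℕ.+ count w i k                        ≡⟨ sum-update ℕ.+-0-commutativeMonoid (count v i) (count w i) k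
                                                                     (λ q q≢k → cong (λ m → indicator (toℕ i ℕ.<? m)) (largerBefore-cover-other q q≢k)) ⟩
      ∑ℕ.sum (count w i) ℕ.+ count v i k                        ≡⟨ cong (∑ℕ.sum (count w i) ℕ.+_) (increment i) ⟩
      ∑ℕ.sum (count w i) ℕ.+ (lookup (x l) i ℕ.+ count w i k)   ≡⟨ ℕ.+-assoc (∑ℕ.sum (count w i)) _ _ ⟨
      ∑ℕ.sum (count w i) ℕ.+ lookup (x l) i ℕ.+ count w i k     ∎) ⟩
    ∑ℕ.sum (count w i) ℕ.+ lookup (x l) i ≡⟨ cong (ℕ._+ lookup (x l) i) (lookup∘tabulate _ i) ⟨
    lookup (top w) i ℕ.+ lookup (x l) i   ≡⟨ lookup-· (top w) (x l) i ⟨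
    lookup (top w · x l) i                ∎
    where
    count : Permutation′ n → Fin n → Fin n → ℕ
    count u i q = indicator (toℕ i ℕ.<? largerBefore u q)
    increment : ∀ i → count v i k ≡ lookup (x l) i ℕ.+ count w i k
    increment i rewrite largerBefore-cover | sym l≡ = case i ≟ l of λ where
      (yes refl) → trans (indicator-true (toℕ l ℕ.<? suc (toℕ l)) ℕ.≤-refl)
        (sym (cong₂ ℕ._+_ (lookup-x-same l) (indicator-false (toℕ l ℕ.<? toℕ l) (ℕ.<-irrefl refl))))
      (no i≢l) → trans
        (indicator-cong (toℕ i ℕ.<? suc (toℕ l)) (toℕ i ℕ.<? toℕ l)
          (λ i<1+l → ℕ.≤∧≢⇒< (ℕ.≤-pred i<1+l) (i≢l ∘ toℕ-injective)) ℕ.m<n⇒m<1+n)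
        (cong (ℕ._+ indicator (toℕ i ℕ.<? toℕ l)) (sym (lookup-x-other i≢l)))

-- Bruhat order and leaps

weight-resp : ∀ (f g : Fin n → ℕ) {w v} → w Perm.≈ v → weight f g w ≡ weight f g v
weight-resp f g w≈v = ∑ℕ.sum-cong-≗ λ k → cong (λ m → f k ℕ.* g m) (w≈v k)

Monotone : (Fin n → ℕ) → Set
Monotone f = ∀ {i j} → i Fin.≤ j → f i ℕ.≤ f j

-- For up-sets this is the easy half of the rank criterion for Bruhat order: every step subtracts a
-- product of nonnegative differences.
weight-antimono : ∀ {f g : Fin n → ℕ} → Monotone f → Monotone g → ∀ {w v} → w <ᴮ v →
                  weight f g v ℕ.≤ weight f g w
weight-antimono {n} {f} {g} f-mono g-mono = go
  where
  step : ∀ {w v} → BruhatStep w v → weight f g v ℕ.≤ weight f g w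
  step {w} {v} (i , j , i<j , wi<wj , v≈) = subst₂ ℕ._≤_ (sym (weight-resp f g {v} {w ·t[ i , j ]} v≈))
    (weight-step f g w _ _ (<⇒≢ i<j) (sym (ℕ.m+[n∸m]≡n (f-mono (ℕ.<⇒≤ i<j)))) (sym (ℕ.m+[n∸m]≡n (g-mono (ℕ.<⇒≤ wi<wj)))))
    (ℕ.m≤m+n _ _)
  go : ∀ {w v} → w <ᴮ v → weight f g v ℕ.≤ weight f g w
  go {w = w} {v} [ s ]⁺ = step {w = w} {v} s
  go {w = w} (_∷⁺_ {y = u} s r) = ℕ.≤-trans (go r) (step {w = w} {u} s)

coinversion-antimono : ∀ {w v : Permutation′ n} → w <ᴮ v → coinversion v ℕ.< coinversion w
coinversion-antimono = go
  where
  step : ∀ {w v : Permutation′ n} → BruhatStep w v → coinversion v ℕ.< coinversion w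
  step {w = w} {v} (i , j , i<j , wi<wj , v≈) =
    subst (ℕ._< coinversion w) (sym (weight-resp toℕ toℕ {v} {w ·t[ i , j ]} v≈)) (coinversion-step w i<j wi<wj)
  go : ∀ {w v : Permutation′ n} → w <ᴮ v → coinversion v ℕ.< coinversion w
  go {w = w} {v} [ s ]⁺ = step {w = w} {v} s
  go {w = w} (_∷⁺_ {y = u} s r) = ℕ.<-trans (go r) (step {w = w} {u} s)

record UpSet (n : ℕ) : Set₁ where
  field
    member  : Fin n → Set
    member? : Decidable member
    closed  : ∀ {i j} → i Fin.≤ j → member i → member j

  characteristic : Fin n → ℕ
  characteristic k = indicator (member? k)

  jump : ∀ {i j} → ¬ member i → member j → characteristic j ≡ characteristic i ℕ.+ 1
  jump {i} {j} i∉ j∈ rewrite indicator-true (member? j) j∈ | indicator-false (member? i) i∉ = refl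

  crosses : ∀ {i j} → i Fin.≤ j → 0 ℕ.< characteristic j ∸ characteristic i → ¬ member i × member j
  crosses {i} {j} i≤j 0< with member? i | member? j
  ... | no i∉  | yes j∈ = i∉ , j∈
  ... | yes i∈ | no j∉  = ⊥-elim (j∉ (closed i≤j i∈))

open UpSet

above atLeast : Fin n → UpSet n
above i = record
  { member = λ k → i Fin.< k ; member? = i <?_ ; closed = λ k≤l i<k → ℕ.<-≤-trans i<k k≤l }
atLeast j = record
  { member = λ k → j Fin.≤ k ; member? = λ k → toℕ j ℕ.≤? toℕ k ; closed = λ k≤l j≤k → ℕ.≤-trans j≤k k≤l }

-- If w t_{ij} ≤ w t_{ak} in Bruhat order, then the rectangle of the first step
-- lies in that of the second: compare the weights of a product of up-sets.
rectangle-inclusion : ∀ {w : Permutation′ n} {a k i j} (A B : UpSet n) →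
                      a Fin.< k → (w ⟨$⟩ʳ a) Fin.< (w ⟨$⟩ʳ k) → i ≢ j →
                      ¬ member A i → member A j → ¬ member B (w ⟨$⟩ʳ i) → member B (w ⟨$⟩ʳ j) →
                      ∀ {u} → u Perm.≈ (w ·t[ i , j ]) → u <ᴮ (w ·t[ a , k ]) →
                      (¬ member A a × member A k) × (¬ member B (w ⟨$⟩ʳ a) × member B (w ⟨$⟩ʳ k))
rectangle-inclusion {n} {w} {a} {k} {i} {j} A B a<k wa<wk i≢j i∉A j∈A wi∉B wj∈B {u} u≈ u<v =
  crosses A (ℕ.<⇒≤ a<k) (ℕ.n≢0⇒n>0 λ d≡0 → product≢0 (cong (ℕ._* e) d≡0)) ,
  crosses B (ℕ.<⇒≤ wa<wk) (ℕ.n≢0⇒n>0 λ e≡0 → product≢0 (trans (cong (d ℕ.*_) e≡0) (ℕ.*-zeroʳ d)))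
  where
  f = characteristic A
  g = characteristic B
  d = f k ∸ f a
  e = g (w ⟨$⟩ʳ k) ∸ g (w ⟨$⟩ʳ a)
  v = w ·t[ a , k ]
  mono : (C : UpSet n) → Monotone (characteristic C)
  mono C {p} {q} p≤q = indicator-mono (member? C p) (member? C q) (closed C p≤q)
  weight-u : weight f g u ℕ.+ 1 ≡ weight f g w
  weight-u = trans (cong (ℕ._+ 1) (weight-resp f g {u} {w ·t[ i , j ]} u≈))
                   (weight-step f g w 1 1 i≢j (jump A i∉A j∈A) (jump B wi∉B wj∈B))
  weight-v : weight f g v ℕ.+ d ℕ.* e ≡ weight f g w
  weight-v = weight-step f g w d e (<⇒≢ a<k)
    (sym (ℕ.m+[n∸m]≡n (mono A (ℕ.<⇒≤ a<k)))) (sym (ℕ.m+[n∸m]≡n (mono B (ℕ.<⇒≤ wa<wk))))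
  -- The step to `u` already lowers the weight by one, and going on to `v` cannot raise it again. So
  -- exchanging `a` and `k` must lower it too, which requires both differences to be positive.
  product≢0 : d ℕ.* e ≢ 0
  product≢0 de≡0 = ℕ.<⇒≱ (ℕ.m<m+n (weight f g u) (s≤s z≤n))
    (subst (ℕ._≤ weight f g u) (sym weight-u≡weight-v) (weight-antimono (mono A) (mono B) u<v))
    where
    weight-u≡weight-v : weight f g u ℕ.+ 1 ≡ weight f g v
    weight-u≡weight-v = begin
      weight f g u ℕ.+ 1         ≡⟨ weight-u ⟩
      weight f g w               ≡⟨ weight-v ⟨
      weight f g v ℕ.+ d ℕ.* e   ≡⟨ cong (weight f g v ℕ.+_) de≡0 ⟩
      weight f g v ℕ.+ 0         ≡⟨ ℕ.+-identityʳ _ ⟩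
      weight f g v               ∎

-- Any chain with an intermediate permutation begins with an exchange whose rectangle lies within
-- that of `a` and `k`. All values strictly between these positions are below w(a), so the
-- rectangles coincide and the first step has already reached the end.
first-larger-⋖ : ∀ (w : Permutation′ n) {a k} → a Fin.< k → (w ⟨$⟩ʳ a) Fin.< (w ⟨$⟩ʳ k) →
                 (∀ m → a Fin.< m → m Fin.< k → (w ⟨$⟩ʳ m) Fin.< (w ⟨$⟩ʳ a)) → w ⋖ (w ·t[ a , k ])
first-larger-⋖ {n} w {a} {k} a<k wa<wk smaller =
  [ (a , k , a<k , wa<wk , λ _ → refl) ]⁺ , λ where
    (u , [ s ]⁺ , u<v) → not-between s u<v
    (u , s ∷⁺ r , u<v) → not-between s (r ++⁺ u<v)
  where
  v = w ·t[ a , k ]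
  not-between : ∀ {u} → BruhatStep w u → ¬ u <ᴮ v
  not-between {u} (i , j , i<j , wi<wj , u≈) u<v = ℕ.<-irrefl
      (weight-resp toℕ toℕ {v} {u} λ m → trans (cong₂ (λ p q → w ⟨$⟩ʳ τ p q m) (sym i≡a) (sym j≡k)) (sym (u≈ m)))
      (coinversion-antimono u<v)
    where
    -- The strict up-sets at the lower corner locate `i`; the non-strict ones at the upper corner
    -- locate `j`.
    lower = rectangle-inclusion {w = w} (above i) (above (w ⟨$⟩ʳ i)) a<k wa<wk (<⇒≢ i<j)
              (ℕ.<-irrefl refl) i<j (ℕ.<-irrefl refl) wi<wj {u} u≈ u<v
    upper = rectangle-inclusion {w = w} (atLeast j) (atLeast (w ⟨$⟩ʳ j)) a<k wa<wk (<⇒≢ i<j)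
              (ℕ.<⇒≱ i<j) ℕ.≤-refl (ℕ.<⇒≱ wi<wj) ℕ.≤-refl {u} u≈ u<v
    i≡a : i ≡ a
    i≡a = case i ≟ a of λ where
      (yes eq) → eq
      (no i≢a) → ⊥-elim (proj₁ (proj₂ lower)
        (smaller i (≮∧≢⇒> (proj₁ (proj₁ lower)) i≢a) (proj₂ (proj₁ lower))))
    j≡k : j ≡ k
    j≡k = case j ≟ k of λ where
      (yes eq) → eq
      (no j≢k) → ⊥-elim (ℕ.<-asym wi<wj (subst (λ m → (w ⟨$⟩ʳ j) Fin.< (w ⟨$⟩ʳ m)) (sym i≡a)
        (smaller j (ℕ.≰⇒> (proj₁ (proj₁ upper))) (ℕ.≤∧≢⇒< (proj₂ (proj₁ upper)) (j≢k ∘ toℕ-injective)))))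

module _ {w : Permutation′ n} {a b : Fin n} (isLeap : IsLeap w a b) where

  open IsLeap isLeap

  leap-agrees : AgreesBefore w a
  leap-agrees k k<a = case (w ⟨$⟩ʳ k) ≟ opposite k of λ where
    (yes eq) → eq
    (no neq) → ⊥-elim (ℕ.<⇒≱ k<a (proj₂ a-min k neq))

  leap-position : a Fin.< b
  leap-position = proj₁ (proj₁ b-min)

  -- Otherwise undoing the exchange would be a Bruhat step from w t_ab back to w, and `coinversion`
  -- would have to drop in both directions.
  leap-value : (w ⟨$⟩ʳ a) Fin.< (w ⟨$⟩ʳ b)
  leap-value = ≮∧≢⇒> (λ wb<wa → ℕ.<-asym (coinversion-antimono (proj₁ (proj₂ (proj₁ b-min)))) (subst (ℕ._< coinversion v)
      (weight-resp toℕ toℕ {v ·t[ a , b ]} {w} λ m → cong (w ⟨$⟩ʳ_) (τ-involutive a b m))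
      (coinversion-step v leap-position
        (subst₂ Fin._<_ (cong (w ⟨$⟩ʳ_) (sym (τ-first a b))) (cong (w ⟨$⟩ʳ_) (sym (τ-second a b))) wb<wa))))
    (<⇒≢ leap-position ∘ sym ∘ permutation-injective w)
    where v = w ·t[ a , b ]

  -- The first later position with a value above w(a) gives a Bruhat cover, so the minimality of `b`
  -- puts `b` no further right.
  leap-smaller : ∀ m → a Fin.< m → m Fin.< b → (w ⟨$⟩ʳ m) Fin.< (w ⟨$⟩ʳ a)
  leap-smaller with search-least (λ m → (a <? m) ×-dec ((w ⟨$⟩ʳ a) <? (w ⟨$⟩ʳ m)))
  ... | inj₁ none = ⊥-elim (none b (leap-position , leap-value))
  ... | inj₂ (k , (a<k , wa<wk) , least) = λ m a<m m<b → smaller m a<m (ℕ.<-≤-trans m<b b≤k)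
    where
    smaller : ∀ m → a Fin.< m → m Fin.< k → (w ⟨$⟩ʳ m) Fin.< (w ⟨$⟩ʳ a)
    smaller m a<m m<k = ≮∧≢⇒> (λ wa<wm → least m m<k (a<m , wa<wm)) (<⇒≢ a<m ∘ permutation-injective w)
    b≤k : b Fin.≤ k
    b≤k = proj₂ b-min k (a<k , first-larger-⋖ w a<k wa<wk smaller)

  leap-cover : Cover w a b
  leap-cover = cover leap-position leap-value λ m a<m m<b wa<wm _ → ℕ.<-asym wa<wm (leap-smaller m a<m m<b)

  top-leap : top (w ·t[ a , b ]) ≡ top w · x a
  top-leap = top-cover w leap-agrees leap-cover a
    (sym (largerBefore-first w leap-agrees leap-position leap-value leap-smaller))

-- Each link starting at `a` multiplies the leading monomial by x_a, and the chain ends at the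
-- staircase; read backwards, every link takes one off the exponent.
top-chain : ∀ {w : Permutation′ n} {C} → LeapingChain w C → map +_ (top w) ≡ wt C
top-chain {n} {w} {C} (done w≈) = lookup-extensional λ k → begin
  lookup (map +_ (top w)) k               ≡⟨ lookup-map k +_ (top w) ⟩
  + lookup (top w) k                      ≡⟨ cong (λ u → + lookup u k) (top-reverse {w = w} w≈) ⟩
  + lookup staircase k                    ≡⟨ cong +_ (lookup∘tabulate _ k) ⟩
  + (n ∸ suc (toℕ k))                     ≡⟨ ℤ.⊖-≥ (toℕ<n k) ⟨
  n ℤ.⊖ suc (toℕ k)                       ≡⟨ ℤ.m-n≡m⊖n n (suc (toℕ k)) ⟨
  + n ℤ.- + suc (toℕ k)                   ≡⟨ ℤ.+-identityʳ _ ⟨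
  + n ℤ.- + suc (toℕ k) ℤ.- + 0           ≡⟨ lookup∘tabulate _ k ⟨
  lookup (wt []) k                        ∎
top-chain {n} {w} (leap {a = a} {b} {C} w≉ isLeap chain) = lookup-extensional λ k → begin
  lookup (map +_ (top w)) k                                     ≡⟨ lookup-map k +_ (top w) ⟩
  + lookup (top w) k                                            ≡⟨ add-subtract (+ lookup (top w) k) (+ lookup (x a) k) ⟩
  (+ lookup (top w) k ℤ.+ + lookup (x a) k) ℤ.- + lookup (x a) k ≡⟨ cong (λ u → + u ℤ.- + lookup (x a) k) (lookup-· (top w) (x a) k) ⟨
  + lookup (top w · x a) k ℤ.- + lookup (x a) k                 ≡⟨ cong (λ u → + lookup u k ℤ.- + lookup (x a) k) (top-leap isLeap) ⟨
  + lookup (top v) k ℤ.- + lookup (x a) k                       ≡⟨ cong (ℤ._- + lookup (x a) k) (lookup-map k +_ (top v)) ⟨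
  lookup (map +_ (top v)) k ℤ.- + lookup (x a) k                ≡⟨ cong (λ u → lookup u k ℤ.- + lookup (x a) k) (top-chain chain) ⟩
  lookup (wt C) k ℤ.- + lookup (x a) k                          ≡⟨ cong (ℤ._- + lookup (x a) k) (lookup∘tabulate _ k) ⟩
  + n ℤ.- + suc (toℕ k) ℤ.- + linksFrom k C ℤ.- + lookup (x a) k ≡⟨ regroup (+ n ℤ.- + suc (toℕ k)) (+ linksFrom k C) (+ lookup (x a) k) ⟩
  + n ℤ.- + suc (toℕ k) ℤ.- + (lookup (x a) k ℕ.+ linksFrom k C) ≡⟨ cong (λ m → + n ℤ.- + suc (toℕ k) ℤ.- + m) (linksFrom-∷ k) ⟨
  + n ℤ.- + suc (toℕ k) ℤ.- + linksFrom k ((a , b) ∷ C)         ≡⟨ lookup∘tabulate _ k ⟨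
  lookup (wt ((a , b) ∷ C)) k                                   ∎
  where
  v = w ·t[ a , b ]
  add-subtract : ∀ p q → p ≡ (p ℤ.+ q) ℤ.- q
  add-subtract = solve-∀
  regroup : ∀ p q r → p ℤ.- q ℤ.- r ≡ p ℤ.- (r ℤ.+ q)
  regroup = solve-∀
  linksFrom-∷ : ∀ k → linksFrom k ((a , b) ∷ C) ≡ lookup (x a) k ℕ.+ linksFrom k C
  linksFrom-∷ k with a ≟ k
  ... | yes refl = sym (cong (ℕ._+ linksFrom k C) (lookup-x-same a))
  ... | no a≢k = sym (cong (ℕ._+ linksFrom k C) (lookup-x-other (a≢k ∘ sym)))

-- Leading monomials

sum-nonnegative : ∀ {f : Fin n → ℤ} → (∀ k → 0ℤ ℤ.≤ f k) → 0ℤ ℤ.≤ ∑ℤ.sum f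
sum-nonnegative {zero} 0≤f = ℤ.≤-refl
sum-nonnegative {suc n} 0≤f = ℤ.+-mono-≤ (0≤f zero) (sum-nonnegative (0≤f ∘ suc))

sum-positive : ∀ {f : Fin n → ℤ} → (∀ k → 0ℤ ℤ.≤ f k) → ∀ i → 0ℤ ℤ.< f i → 0ℤ ℤ.< ∑ℤ.sum f
sum-positive 0≤f zero 0<fi = ℤ.+-mono-<-≤ 0<fi (sum-nonnegative (0≤f ∘ suc))
sum-positive 0≤f (suc i) 0<fi = ℤ.+-mono-≤-< (0≤f zero) (sum-positive (0≤f ∘ suc) i 0<fi)

sum-nonzero : ∀ {f : Fin n → ℤ} → ∑ℤ.sum f ≢ 0ℤ → ∃[ k ] f k ≢ 0ℤ
sum-nonzero {n} {f} Σf≢0 = ¬∀⟶∃¬ n (λ k → f k ≡ 0ℤ) (λ k → f k ℤ.≟ 0ℤ)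
  λ f≡0 → Σf≢0 (trans (∑ℤ.sum-cong-≗ f≡0) (∑ℤ.sum-replicate-zero n))

module Leading {ℓ : Level} {n : ℕ} (𝔖 : Permutation′ n → Polynomial n) (isSchubert : IsSchubertFamily 𝔖)
               (_≼_ : Rel (Monomial n) ℓ) (isTermOrder : IsTermOrder _≼_) (decreasing : VariablesDecreasing _≼_) where

  open IsSchubertFamily isSchubert
  open Schubert 𝔖 isSchubert
  open IsTermOrder isTermOrder
  open IsTotalOrder isTotalOrder using (total; antisym; reflexive) renaming (trans to ≼-trans)

  -- If the order were reversed, multiplying by `t` and antisymmetry would make the products equal,
  -- and exponents cancel.
  ·-cancelʳ-≼ : ∀ t {u v} → (u · t) ≼ (v · t) → u ≼ v
  ·-cancelʳ-≼ t {u} {v} ut≼vt with total u v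
  ... | inj₁ u≼v = u≼v
  ... | inj₂ v≼u = reflexive (·-cancelʳ t (antisym ut≼vt (·-monoˡ t v≼u)))

  x-antimono : ∀ {i j} → i Fin.≤ j → x j ≼ x i
  x-antimono {i} {j} i≤j = case i ≟ j of λ where
    (yes refl) → reflexive refl
    (no i≢j) → proj₁ (decreasing (ℕ.≤∧≢⇒< i≤j (i≢j ∘ toℕ-injective)))

  S-expand : ∀ w a → AgreesBefore w a → (w ⟨$⟩ʳ a) ≢ opposite a →
             ∀ v → S w v ≡ ∑ℤ.sum (λ k → term w a k (v · x a))
  S-expand w a agrees wa≢ v = trans (sym (shift-times a (S w) v)) (transition w a agrees wa≢ (v · x a))

  S-reverse : ∀ w → w Perm.≈ reverse → S w ≗ coeff ⟦ staircase ⟧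
  S-reverse w w≈ v = trans (respects {w} {reverse} w≈ v) (longest v)

  S-nonnegative : ∀ w v → 0ℤ ℤ.≤ S w v
  S-nonnegative w v = go w v (<-wellFounded (coinversion w))
    where
    go : ∀ w v → Acc ℕ._<_ (coinversion w) → 0ℤ ℤ.≤ S w v
    go w v (acc rec) with first-difference w
    ... | inj₁ w≈ = subst (0ℤ ℤ.≤_) (sym (S-reverse w w≈ v)) coefficient
      where
      coefficient : 0ℤ ℤ.≤ coeff ⟦ staircase ⟧ v
      coefficient with does (≡-dec ℕ._≟_ staircase v)
      ... | true = +≤+ z≤n
      ... | false = +≤+ z≤n
    ... | inj₂ (a , agrees , wa≢) = subst (0ℤ ℤ.≤_) (sym (S-expand w a agrees wa≢ v)) (sum-nonnegative λ k →
      case cover? w a k of λ where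
        (yes c) → subst (0ℤ ℤ.≤_) (sym (term-cover c (v · x a)))
                    (go (w ·t[ a , k ]) (v · x a) (rec (coinversion-step w (position c) (value c))))
        (no ¬c) → subst (0ℤ ℤ.≤_) (sym (term-¬cover ¬c (v · x a))) ℤ.≤-refl)

  -- A monomial of 𝔖_w times x_a occurs in some term of the transition formula. The induction bounds
  -- it there by `top w` times x_l with l ≥ a, and x_a is cancelled at the end.
  S-bounded : ∀ w v → S w v ≢ 0ℤ → v ≼ top w
  S-bounded w v = go w v (<-wellFounded (coinversion w))
    where
    go : ∀ w v → Acc ℕ._<_ (coinversion w) → S w v ≢ 0ℤ → v ≼ top w
    go w v (acc rec) Swv≢0 with first-difference w
    ... | inj₁ w≈ = reflexive (trans (sym equal) (sym (top-reverse {w = w} w≈)))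
      where
      equal : staircase ≡ v
      equal with ≡-dec ℕ._≟_ staircase v | S-reverse w w≈ v
      ... | yes eq | _ = eq
      ... | no _ | Swv≡0 = ⊥-elim (Swv≢0 Swv≡0)
    ... | inj₂ (a , agrees , wa≢) with sum-nonzero (Swv≢0 ∘ trans (S-expand w a agrees wa≢ v))
    ...   | k , term≢0 = case cover? w a k of λ where
          (no ¬c) → ⊥-elim (term≢0 (term-¬cover ¬c (v · x a)))
          (yes c) → ·-cancelʳ-≼ (x a) (≼-trans
            (go (w ·t[ a , k ]) (v · x a) (rec (coinversion-step w (position c) (value c)))
                (term≢0 ∘ trans (term-cover c (v · x a))))
            (bound c))
      where
      bound : Cover w a k → top (w ·t[ a , k ]) ≼ (top w · x a)
      bound c = subst₂ _≼_ (trans (·-comm (x l) (top w)) (sym (top-cover w agrees c l l≡))) (·-comm (x a) (top w))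
        (·-monoˡ (top w) (x-antimono (subst (toℕ a ℕ.≤_) (sym l≡) (largerBefore-≥ w agrees (ℕ.<⇒≤ (position c))))))
        where
        l<n = ℕ.≤-<-trans (largerBefore-≤ w k) (toℕ<n k)
        l = fromℕ< l<n
        l≡ = toℕ-fromℕ< l<n

  -- Positivity, unlike nonvanishing, survives adding the other nonnegative terms. The recursion
  -- follows the chain, since `top-leap` makes the leap term carry exactly the monomial
  -- `top w · x a`.
  S-top-positive : ∀ {w C} → LeapingChain w C → 0ℤ ℤ.< S w (top w)
  S-top-positive {w} (done w≈) = subst (0ℤ ℤ.<_) (sym coefficient) (+<+ (s≤s z≤n))
    where
    coefficient : S w (top w) ≡ 1ℤ
    coefficient = trans (S-reverse w w≈ (top w))
      (cong (λ b → (if b then 1ℤ else 0ℤ) ℤ.+ 0ℤ)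
        (dec-true (≡-dec ℕ._≟_ staircase (top w)) (sym (top-reverse {w = w} w≈))))
  S-top-positive {w} (leap {a = a} {b} _ isLeap chain) = subst (0ℤ ℤ.<_)
    (sym (S-expand w a (leap-agrees isLeap) (proj₁ (IsLeap.a-min isLeap)) (top w)))
    (sum-positive nonnegative b (subst (0ℤ ℤ.<_)
      (sym (trans (term-cover (leap-cover isLeap) (top w · x a)) (cong (S (w ·t[ a , b ])) (sym (top-leap isLeap)))))
      (S-top-positive chain)))
    where
    nonnegative : ∀ k → 0ℤ ℤ.≤ term w a k (top w · x a)
    nonnegative k with does (cover? w a k)
    ... | true = S-nonnegative (w ·t[ a , k ]) (top w · x a)
    ... | false = ℤ.≤-refl

-- Entries of `wt C` are integers, so an exponent vector is asserted to exist; the witness `top w`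
-- thus also shows that no entry is negative.
theorem11p8 : ∀ {ℓ : Level} (n : ℕ)
    (𝔖 : Permutation′ n → Polynomial n) → IsSchubertFamily 𝔖 →
    (w : Permutation′ n) (C : Chain n) → LeapingChain w C →
    (_≼_ : Rel (Monomial n) ℓ) → IsTermOrder _≼_ → VariablesDecreasing _≼_ →
    ∃[ u ] (map +_ u ≡ wt C × IsLeadingMonomial _≼_ (𝔖 w) u)
theorem11p8 n 𝔖 isSchubert w C chain _≼_ isTermOrder decreasing =
  top w , top-chain chain , (λ eq → ℤ.<-irrefl (sym eq) (S-top-positive chain)) , S-bounded w
  where open Leading 𝔖 isSchubert _≼_ isTermOrder decreasing
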